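{- For any pair of integers $s,h\ge 2$ there exists $n_0=n_0(h,s)$ such that for all $n\ge n_0$, $$La_{rp}(n,\{Y_{h,s},Y'_{h,s}\})=\Sigma(n,h)=\sum_{i=1}^{h}\binom{n}{\lfloor (n-h)/2\rfloor+i}.$$
   Context: $Y_{h,s}$ denotes the poset on $h+s$ elements $x_1,\dots,x_h,y_1,\dots,y_s$ with $x_1<x_2<\dots<x_h<y_j$ for every $j$ (and the $y_j$ pairwise incomparable); it is graded with rank $\rho(x_i)=i$ and $\rho(y_j)=h+1$. $Y'_{h,s}$ denotes its dual poset (same elements, order reversed), graded correspondingly ($y_j$ of rank $0$, $x_i$ of rank $h+1-i$). For a family $\mathcal F$ of subsets of $[n]=\{1,\dots,n\}$, a subfamily $\mathcal G\subseteq\mathcal F$ is a rank-preserving copy of a graded poset $P$ with rank function $\rho$ if there is a bijection $\phi:P\to\mathcal G$ such that $\phi(x)\subseteq\phi(y)$ whenever $x\le_P y$, and $|\phi(x)|=|\phi(y)|$ whenever $\rho(x)=\rho(y)$. $La_{rp}(n,\{Y_{h,s},Y'_{h,s}\})$ denotes the maximum size of a family $\mathcal F\subseteq 2^{[n]}$ containing neither a rank-preserving copy of $Y_{h,s}$ nor a rank-preserving copy of $Y'_{h,s}$. $\Sigma(n,h)$ is the number of sets in the $h$ middle layers of $2^{[n]}$. -}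

module Defs where

open import Data.Nat using (ℕ; zero; suc; _+_; _∸_; _≤_)
open import Data.Nat.DivMod using (_/_)
open import Data.Nat.Combinatorics using (_C_)
open import Data.Fin using (Fin; toℕ)
open import Data.Fin.Subset using (Subset; _⊆_; ∣_∣)
open import Data.List using (List; length)
open import Data.List.Membership.Propositional using (_∈_)
open import Data.List.Relation.Unary.Unique.Propositional using (Unique)
open import Data.Product using (Σ; _×_; ∃)
open import Relation.Nullary using (¬_)
open import Relation.Binary.PropositionalEquality using (_≡_; _≢_)

record Family (n : ℕ) : Set where
  constructor family
  field
    sets   : List (Subset n)
    unique : Unique sets
open Family public

-- A rank-preserving copy of Y_{h,s} in F: x_i ↦ X i (i ∈ Fin h, indices 0-based),
-- y_j ↦ Y j (j ∈ Fin s), all distinct members of F, with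
-- X i ⊆ X i' for i ≤ i', X i ⊆ Y j, and all Y j of equal size
-- (the x_i have pairwise distinct ranks, so impose no size condition).
record CopyY {n : ℕ} (h s : ℕ) (F : List (Subset n)) : Set where
  field
    X : Fin h → Subset n
    Y : Fin s → Subset n
    X∈ : ∀ i → X i ∈ F
    Y∈ : ∀ j → Y j ∈ F
    X-inj : ∀ i i' → X i ≡ X i' → i ≡ i'
    Y-inj : ∀ j j' → Y j ≡ Y j' → j ≡ j'
    XY-dist : ∀ i j → X i ≢ Y j
    X-chain : ∀ i i' → toℕ i ≤ toℕ i' → X i ⊆ X i'
    X⊆Y : ∀ i j → X i ⊆ Y j
    Y-rank : ∀ j j' → ∣ Y j ∣ ≡ ∣ Y j' ∣

record CopyY' {n : ℕ} (h s : ℕ) (F : List (Subset n)) : Set where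
  field
    X : Fin h → Subset n
    Y : Fin s → Subset n
    X∈ : ∀ i → X i ∈ F
    Y∈ : ∀ j → Y j ∈ F
    X-inj : ∀ i i' → X i ≡ X i' → i ≡ i'
    Y-inj : ∀ j j' → Y j ≡ Y j' → j ≡ j'
    XY-dist : ∀ i j → X i ≢ Y j
    X-chain : ∀ i i' → toℕ i ≤ toℕ i' → X i' ⊆ X i
    Y⊆X : ∀ i j → Y j ⊆ X i
    Y-rank : ∀ j j' → ∣ Y j ∣ ≡ ∣ Y j' ∣

Free : {n : ℕ} (h s : ℕ) → Family n → Set
Free h s F = ¬ CopyY h s (sets F) × ¬ CopyY' h s (sets F)

LaRpIs : (n h s m : ℕ) → Set
LaRpIs n h s m =
  (Σ (Family n) λ F → Free h s F × length (sets F) ≡ m) ×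
  (∀ (F : Family n) → Free h s F → length (sets F) ≤ m)

sumBinom : (n b k : ℕ) → ℕ
sumBinom n b zero = 0
sumBinom n b (suc k) = sumBinom n b k + n C (b + suc k)

Sigma : (n h : ℕ) → ℕ
Sigma n h = sumBinom n ((n ∸ h) / 2) h

{-# OPTIONS --safe #-}

-- Call a member of F high if it tops a chain of h members of F.  Without a copy
-- of Y, at most s - 1 members of each size lie above a high set B, so a random
-- maximal chain through B meets on average at most half a member of F above B,
-- provided that F has no sets of size close to n.  Dually for low sets.  If a
-- maximal chain meets F in k > h sets, then at least k - h of them come after
-- its first high set and at least k - h before its last low set, which on
-- average pays for the excess k - h.  Hence the Lubell function of F is at most
-- h, and |F| ≤ Σ(n,h) follows as in the LYM inequality.
--
-- If F has a member E of bounded size, then its Lubell function inside [E , [n]]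
-- is at most h - 1/2, while the rest of the cube splits into |E| intervals where
-- it is at most h.  So |F| falls short of h C(n,n/2) by a constant fraction of
-- C(n,n/2), more than the number of sets of extreme size and the difference
-- between h C(n,n/2) and Σ(n,h) together.  Large sets are treated by complements.
module Submission where

open import Defs
open import Data.Nat
open import Data.Nat.Properties
open import Data.Nat.Combinatorics using (_C_; nCk≡n!/k![n-k]!; k![n∸k]!∣n!; nCk≡nC[n∸k]; nCn≡1; nCk+nC[k+1]≡[n+1]C[k+1]; k>n⇒nCk≡0)
open import Data.Nat.DivMod using (m/n*n≡m; m≡m%n+[m/n]*n; m%n<n)
open import Data.Nat.Tactic.RingSolver using (solve-∀)
open import Algebra.Properties.CommutativeSemigroup +-commutativeSemigroup using () renaming (interchange to +-interchange)
open import Data.Bool using (Bool; true; false; not; _∧_) renaming (_≟_ to _≟ᵇ_)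
open import Data.Bool.Properties using (not-involutive; ∧-comm)
open import Data.Fin using (Fin; zero; suc; toℕ; fromℕ<; inject≤) renaming (_≟_ to _≟ᶠ_)
open import Data.Fin.Properties using (toℕ<n; toℕ-injective; toℕ-fromℕ<; inject≤-injective)
open import Data.Fin.Subset using (Subset; _⊆_; ∣_∣; ∁) renaming (⊥ to ∅; ⊤ to full)
open import Data.Fin.Subset.Properties using (_⊆?_; ⊆-trans; ⊆-min; ⊆-max; p⊆q⇒∣p∣≤∣q∣; drop-∷-⊆; p⊆q⇒∁p⊇∁q; ∣∁p∣≡n∸∣p∣; ∣p∣≤n; ∣⊤∣≡n; ∣⊥∣≡0)
open import Data.List using (List; []; _∷_; _∷ʳ_; _++_; map; filter; length; allFin; drop) renaming (lookup to lookupᴸ)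
open import Data.List.Properties using (map-tabulate; map-cong; map-id; map-∘; length-++; length-map)
open import Data.List.Membership.Propositional using (_∈_; find; lose)
open import Data.List.Membership.Propositional.Properties using (∈-map⁺; ∈-map⁻; ∈-filter⁻; ∈-++⁻; ∈-lookup)
open import Data.List.Relation.Unary.Any as Any using (Any; here; there; any?)
open import Data.List.Relation.Unary.All as All using (All; []; _∷_)
open import Data.List.Relation.Unary.AllPairs using (AllPairs; []; _∷_)
open import Data.List.Relation.Unary.AllPairs.Properties using () renaming (++⁺ to AllPairs-++⁺)
open import Data.List.Relation.Unary.Unique.Propositional using (Unique)
open import Data.List.Relation.Unary.Unique.Propositional.Properties using () renaming (filter⁺ to Unique-filter⁺; map⁺ to Unique-map⁺; ++⁺ to Unique-++⁺)
open import Data.Vec using ([]; _∷_; here; lookup; _[_]≔_)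
open import Data.Vec.Properties using (lookup∘update; lookup∘update′; lookup-map; []=⇒lookup; lookup⇒[]=; map-[]≔; ≡-dec; ∷-injectiveʳ) renaming (map-∘ to map-∘ⱽ; map-id to map-idⱽ; map-cong to map-congⱽ)
open import Data.Product using (_×_; _,_; proj₁; proj₂; ∃)
open import Data.Sum using (_⊎_; inj₁; inj₂)
open import Data.Empty using (⊥-elim)
open import Data.Unit using (⊤; tt)
open import Function using (_∘_; id)
open import Relation.Nullary using (¬_; Dec; yes; no)
open import Relation.Nullary.Decidable using (_×-dec_)
open import Relation.Binary.PropositionalEquality
open import Relation.Binary.Definitions using (tri<; tri≈; tri>)


-- A single chain may well contain more than h counted members. What holds for each chain is 2k + b
-- + b′ ≤ 2h + 2a + 2a′: here k is its number of members, b tells whether it meets a set of `W`, a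
-- counts the members after the first such set, and b′, a′ are the same for the complements. The
-- bound one half says that 2a ≤ b and 2a′ ≤ b′ on average, which leaves k ≤ h. Equality occurs at k
-- = h - 1, b = b′ = 1, a = a′ = 0 and at k = h + 1 with all four equal to 1, so one half is exactly
-- what this inequality can bear.
--
-- Two families are carried along: F certifies heights and supplies the forbidden copies, while G, a
-- part of F, is what is counted. This lets a small E raise heights although sets of extreme size
-- are left out of the count.
--
-- Nothing is divided: averages are compared as sums over the d! maximal chains, and an error of z/M
-- takes the form M x ≤ M y + z. In the main estimates the h of the theorem is `2 + h`, its s is
-- `suc s`, and a high set B has `Ht F (suc h) B`.

-- Indicators and finite sums

ind : {P : Set} → Dec P → ℕ
ind (yes _) = 1
ind (no _) = 0

ind-yes : {P : Set} (d : Dec P) → P → ind d ≡ 1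
ind-yes (yes _) p = refl
ind-yes (no ¬p) p = ⊥-elim (¬p p)

ind-no : {P : Set} (d : Dec P) → ¬ P → ind d ≡ 0
ind-no (yes p) ¬p = ⊥-elim (¬p p)
ind-no (no _) ¬p = refl

ind-mono : {P Q : Set} (d : Dec P) (e : Dec Q) → (P → Q) → ind d ≤ ind e
ind-mono (no _) e i = z≤n
ind-mono (yes p) e i = ≤-reflexive (sym (ind-yes e (i p)))

ind-cong : {P Q : Set} (d : Dec P) (e : Dec Q) → (P → Q) → (Q → P) → ind d ≡ ind e
ind-cong d e i j = ≤-antisym (ind-mono d e i) (ind-mono e d j)

ind≤1 : {P : Set} (d : Dec P) → ind d ≤ 1
ind≤1 (yes _) = ≤-refl
ind≤1 (no _) = z≤n

∑ : {A : Set} → List A → (A → ℕ) → ℕ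
∑ [] f = 0
∑ (x ∷ xs) f = f x + ∑ xs f

module _ {A : Set} where

  ∑-cong∈ : ∀ (xs : List A) {f g} → (∀ x → x ∈ xs → f x ≡ g x) → ∑ xs f ≡ ∑ xs g
  ∑-cong∈ [] e = refl
  ∑-cong∈ (x ∷ xs) e = cong₂ _+_ (e x (here refl)) (∑-cong∈ xs (λ y → e y ∘ there))

  ∑-cong : ∀ (xs : List A) {f g} → (∀ x → f x ≡ g x) → ∑ xs f ≡ ∑ xs g
  ∑-cong xs e = ∑-cong∈ xs (λ x _ → e x)

  ∑-mono : ∀ (xs : List A) {f g} → (∀ x → x ∈ xs → f x ≤ g x) → ∑ xs f ≤ ∑ xs g
  ∑-mono [] e = z≤n
  ∑-mono (x ∷ xs) e = +-mono-≤ (e x (here refl)) (∑-mono xs (λ y → e y ∘ there))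

  ∑-+ : ∀ (xs : List A) f g → ∑ xs (λ x → f x + g x) ≡ ∑ xs f + ∑ xs g
  ∑-+ [] f g = refl
  ∑-+ (x ∷ xs) f g rewrite ∑-+ xs f g = +-interchange (f x) (g x) (∑ xs f) (∑ xs g)

  ∑-* : ∀ (xs : List A) k f → ∑ xs (λ x → k * f x) ≡ k * ∑ xs f
  ∑-* [] k f = sym (*-zeroʳ k)
  ∑-* (x ∷ xs) k f rewrite ∑-* xs k f = sym (*-distribˡ-+ k (f x) (∑ xs f))

  ∑-const : ∀ (xs : List A) k → ∑ xs (λ _ → k) ≡ length xs * k
  ∑-const [] k = refl
  ∑-const (x ∷ xs) k = cong (k +_) (∑-const xs k)

  ∑-zero : ∀ (xs : List A) {f} → (∀ x → x ∈ xs → f x ≡ 0) → ∑ xs f ≡ 0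
  ∑-zero xs e = trans (∑-cong∈ xs e) (trans (∑-const xs 0) (*-zeroʳ (length xs)))

  ∑-++ : ∀ (xs ys : List A) f → ∑ (xs ++ ys) f ≡ ∑ xs f + ∑ ys f
  ∑-++ [] ys f = refl
  ∑-++ (x ∷ xs) ys f rewrite ∑-++ xs ys f = sym (+-assoc (f x) _ _)

  ∑-filter : ∀ {P : A → Set} (P? : ∀ x → Dec (P x)) xs f →
             ∑ (filter P? xs) f ≡ ∑ xs (λ x → ind (P? x) * f x)
  ∑-filter P? [] f = refl
  ∑-filter P? (x ∷ xs) f with P? x
  ... | yes _ = cong₂ _+_ (sym (+-identityʳ (f x))) (∑-filter P? xs f)
  ... | no _ = ∑-filter P? xs f

  length-filter-ind : ∀ {P : A → Set} (P? : ∀ x → Dec (P x)) xs →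
                      length (filter P? xs) ≡ ∑ xs (λ x → ind (P? x))
  length-filter-ind P? [] = refl
  length-filter-ind P? (x ∷ xs) with P? x
  ... | yes _ = cong suc (length-filter-ind P? xs)
  ... | no _ = length-filter-ind P? xs

  ∑-map : ∀ {B : Set} (h : A → B) xs f → ∑ (map h xs) f ≡ ∑ xs (f ∘ h)
  ∑-map h [] f = refl
  ∑-map h (x ∷ xs) f = cong (f (h x) +_) (∑-map h xs f)

∑-swap : ∀ {A B : Set} (xs : List A) (ys : List B) (f : A → B → ℕ) →
         ∑ xs (λ x → ∑ ys (f x)) ≡ ∑ ys (λ y → ∑ xs (λ x → f x y))
∑-swap [] ys f = sym (∑-zero ys (λ _ _ → refl))
∑-swap (x ∷ xs) ys f rewrite ∑-swap xs ys f = sym (∑-+ ys (f x) _)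

∑-allFin-suc : ∀ n f → ∑ (allFin (suc n)) f ≡ f zero + ∑ (allFin n) (f ∘ suc)
∑-allFin-suc n f = cong (f zero +_)
  (trans (cong (λ l → ∑ l f) (sym (map-tabulate {n = n} id suc))) (∑-map suc (allFin n) f))

sumTo : ℕ → (ℕ → ℕ) → ℕ
sumTo zero f = 0
sumTo (suc N) f = sumTo N f + f N

sumTo-cong : ∀ N {f g} → (∀ k → k < N → f k ≡ g k) → sumTo N f ≡ sumTo N g
sumTo-cong zero e = refl
sumTo-cong (suc N) e = cong₂ _+_ (sumTo-cong N (λ k k<N → e k (m<n⇒m<1+n k<N))) (e N ≤-refl)

sumTo-mono : ∀ N {f g} → (∀ k → k < N → f k ≤ g k) → sumTo N f ≤ sumTo N g
sumTo-mono zero e = z≤n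
sumTo-mono (suc N) e = +-mono-≤ (sumTo-mono N (λ k k<N → e k (m<n⇒m<1+n k<N))) (e N ≤-refl)

sumTo-+ : ∀ N f g → sumTo N (λ k → f k + g k) ≡ sumTo N f + sumTo N g
sumTo-+ zero f g = refl
sumTo-+ (suc N) f g rewrite sumTo-+ N f g = +-interchange (sumTo N f) (sumTo N g) (f N) (g N)

sumTo-* : ∀ N k f → sumTo N (λ j → k * f j) ≡ k * sumTo N f
sumTo-* zero k f = sym (*-zeroʳ k)
sumTo-* (suc N) k f rewrite sumTo-* N k f = sym (*-distribˡ-+ k (sumTo N f) (f N))

sumTo-const : ∀ N k → sumTo N (λ _ → k) ≡ N * k
sumTo-const zero k = refl
sumTo-const (suc N) k rewrite sumTo-const N k = +-comm (N * k) k

sumTo-split : ∀ a b f → sumTo (a + b) f ≡ sumTo a f + sumTo b (λ i → f (a + i))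
sumTo-split a zero f rewrite +-identityʳ a = sym (+-identityʳ _)
sumTo-split a (suc b) f rewrite +-suc a b | sumTo-split a b f = +-assoc (sumTo a f) _ _

sumTo-single : ∀ N m (g : ℕ → ℕ) → m < N → sumTo N (λ k → ind (m ≟ k) * g k) ≡ g m
sumTo-single (suc N) m g m<1+N with m ≟ N
... | yes refl = trans (cong (_+ (g m + 0)) rest≡0) (+-identityʳ (g m))
  where
  rest≡0 : sumTo m (λ k → ind (m ≟ k) * g k) ≡ 0
  rest≡0 = trans (sumTo-cong m (λ k k<m → cong (_* g k) (ind-no (m ≟ k) (λ { refl → <-irrefl refl k<m }))))
                 (trans (sumTo-const m 0) (*-zeroʳ m))
... | no m≢N = trans (+-identityʳ _) (sumTo-single N m g (≤∧≢⇒< (s≤s⁻¹ m<1+N) m≢N))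

∑-levels : ∀ {A : Set} (ℓ : A → ℕ) (g : ℕ → ℕ) N (xs : List A) → (∀ x → x ∈ xs → ℓ x < N) →
           ∑ xs (λ x → g (ℓ x)) ≡ sumTo N (λ k → ∑ xs (λ x → ind (ℓ x ≟ k)) * g k)
∑-levels ℓ g N [] b = sym (trans (sumTo-const N 0) (*-zeroʳ N))
∑-levels ℓ g N (x ∷ xs) b = begin
  g (ℓ x) + ∑ xs (λ y → g (ℓ y))
    ≡⟨ cong₂ _+_ (sym (sumTo-single N (ℓ x) g (b x (here refl)))) (∑-levels ℓ g N xs (λ y → b y ∘ there)) ⟩
  sumTo N (λ k → ind (ℓ x ≟ k) * g k) + sumTo N (λ k → ∑ xs (λ y → ind (ℓ y ≟ k)) * g k)
    ≡⟨ sym (sumTo-+ N _ _) ⟩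
  sumTo N (λ k → ind (ℓ x ≟ k) * g k + ∑ xs (λ y → ind (ℓ y ≟ k)) * g k)
    ≡⟨ sumTo-cong N (λ k _ → sym (*-distribʳ-+ (g k) (ind (ℓ x ≟ k)) _)) ⟩
  sumTo N (λ k → ∑ (x ∷ xs) (λ y → ind (ℓ y ≟ k)) * g k) ∎
  where open ≡-Reasoning

-- Subsets: changing one element, complements

infixl 6 _⊕_ _⊖_

_⊕_ _⊖_ : ∀ {n} → Subset n → Fin n → Subset n
P ⊕ i = P [ i ]≔ true
P ⊖ i = P [ i ]≔ false

_≟ˢ_ : ∀ {n} (A B : Subset n) → Dec (A ≡ B)
_≟ˢ_ = ≡-dec _≟ᵇ_

⊆-lookup : ∀ {n} {P Q : Subset n} → P ⊆ Q → ∀ i → lookup P i ≡ true → lookup Q i ≡ true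
⊆-lookup {P = P} P⊆Q i e = []=⇒lookup (P⊆Q (lookup⇒[]= i P e))

lookup-⊆ : ∀ {n} {P Q : Subset n} → (∀ i → lookup P i ≡ true → lookup Q i ≡ true) → P ⊆ Q
lookup-⊆ {Q = Q} f {i} i∈P = lookup⇒[]= i Q (f i ([]=⇒lookup i∈P))

∣⊕∣ : ∀ {n} (P : Subset n) i → lookup P i ≡ false → ∣ P ⊕ i ∣ ≡ suc ∣ P ∣
∣⊕∣ (false ∷ P) zero e = refl
∣⊕∣ (true ∷ P) (suc i) e = cong suc (∣⊕∣ P i e)
∣⊕∣ (false ∷ P) (suc i) e = ∣⊕∣ P i e

∣⊖∣ : ∀ {n} (P : Subset n) i → lookup P i ≡ true → suc ∣ P ⊖ i ∣ ≡ ∣ P ∣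
∣⊖∣ (true ∷ P) zero e = refl
∣⊖∣ (true ∷ P) (suc i) e = cong suc (∣⊖∣ P i e)
∣⊖∣ (false ∷ P) (suc i) e = ∣⊖∣ P i e

⊆-⊕ : ∀ {n} (P : Subset n) i → P ⊆ P ⊕ i
⊆-⊕ P i = lookup-⊆ λ j e → aux j e (i ≟ᶠ j)
  where
  aux : ∀ j → lookup P j ≡ true → Dec (i ≡ j) → lookup (P ⊕ i) j ≡ true
  aux j e (yes refl) = lookup∘update i P true
  aux j e (no i≢j) = trans (lookup∘update′ (i≢j ∘ sym) P true) e

⊕-⊆ : ∀ {n} {P Q : Subset n} {i} → P ⊆ Q → lookup Q i ≡ true → P ⊕ i ⊆ Q
⊕-⊆ {P = P} {Q} {i} P⊆Q q = lookup-⊆ λ j e → aux j e (i ≟ᶠ j)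
  where
  aux : ∀ j → lookup (P ⊕ i) j ≡ true → Dec (i ≡ j) → lookup Q j ≡ true
  aux j e (yes refl) = q
  aux j e (no i≢j) = ⊆-lookup P⊆Q j (trans (sym (lookup∘update′ (i≢j ∘ sym) P true)) e)

⊆-⊖ : ∀ {n} {P Q : Subset n} {i} → P ⊆ Q → lookup P i ≡ false → P ⊆ Q ⊖ i
⊆-⊖ {P = P} {Q} {i} P⊆Q q = lookup-⊆ λ j e → aux j e (i ≟ᶠ j)
  where
  aux : ∀ j → lookup P j ≡ true → Dec (i ≡ j) → lookup (Q ⊖ i) j ≡ true
  aux j e (yes refl) with () ← trans (sym q) e
  aux j e (no i≢j) = trans (lookup∘update′ (i≢j ∘ sym) Q false) (⊆-lookup P⊆Q j e)

⊆∧∣∣⇒≡ : ∀ {n} {P Q : Subset n} → P ⊆ Q → ∣ Q ∣ ≤ ∣ P ∣ → P ≡ Q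
⊆∧∣∣⇒≡ {P = []} {[]} _ _ = refl
⊆∧∣∣⇒≡ {P = true ∷ P} {true ∷ Q} s l = cong (true ∷_) (⊆∧∣∣⇒≡ (drop-∷-⊆ s) (s≤s⁻¹ l))
⊆∧∣∣⇒≡ {P = false ∷ P} {false ∷ Q} s l = cong (false ∷_) (⊆∧∣∣⇒≡ (drop-∷-⊆ s) l)
⊆∧∣∣⇒≡ {P = false ∷ P} {true ∷ Q} s l = ⊥-elim (<-irrefl refl (≤-trans l (p⊆q⇒∣p∣≤∣q∣ (drop-∷-⊆ s))))
⊆∧∣∣⇒≡ {P = true ∷ P} {false ∷ Q} s l with s here
... | ()

∁∁ : ∀ {n} (P : Subset n) → ∁ (∁ P) ≡ P
∁∁ P = trans (sym (map-∘ⱽ not not P)) (trans (map-congⱽ not-involutive P) (map-idⱽ P))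

∁⊖ : ∀ {n} (Q : Subset n) i → ∁ (Q ⊖ i) ≡ ∁ Q ⊕ i
∁⊖ Q i = map-[]≔ not Q i

∁-inj : ∀ {n} {P Q : Subset n} → ∁ P ≡ ∁ Q → P ≡ Q
∁-inj {P = P} {Q} e = trans (sym (∁∁ P)) (trans (cong ∁ e) (∁∁ Q))

∣∁∣ : ∀ {n} (P : Subset n) → ∣ P ∣ + ∣ ∁ P ∣ ≡ n
∣∁∣ P = trans (cong (∣ P ∣ +_) (∣∁p∣≡n∸∣p∣ P)) (m+[n∸m]≡n (∣p∣≤n P))

-- Maximal chains of an interval

isFree : ∀ {n} → Subset n → Subset n → Fin n → Bool
isFree P Q i = not (lookup P i) ∧ lookup Q i

free? : ∀ {n} (P Q : Subset n) i → Dec (isFree P Q i ≡ true)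
free? P Q i = isFree P Q i ≟ᵇ true

free : ∀ {n} → Subset n → Subset n → List (Fin n)
free {n} P Q = filter (free? P Q) (allFin n)

isFree⁻ : ∀ {n} (P Q : Subset n) i → isFree P Q i ≡ true → lookup P i ≡ false × lookup Q i ≡ true
isFree⁻ P Q i e with lookup P i | lookup Q i
isFree⁻ P Q i refl | false | true = refl , refl

isFree⁺ : ∀ {n} (P Q : Subset n) i → lookup P i ≡ false → lookup Q i ≡ true → isFree P Q i ≡ true
isFree⁺ P Q i p q rewrite p | q = refl

∈-free⁻ : ∀ {n} (P Q : Subset n) {i} → i ∈ free P Q → lookup P i ≡ false × lookup Q i ≡ true
∈-free⁻ {n} P Q {i} i∈ = isFree⁻ P Q i (proj₂ (∈-filter⁻ (free? P Q) {xs = allFin n} i∈))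

∣free∣ : ∀ {n} (P Q : Subset n) → P ⊆ Q → ∣ P ∣ + ∑ (allFin n) (λ i → ind (free? P Q i)) ≡ ∣ Q ∣
∣free∣ [] [] _ = refl
∣free∣ {suc n} (p ∷ P) (q ∷ Q) s =
  trans (cong (∣ p ∷ P ∣ +_) (∑-allFin-suc n (λ i → ind (free? (p ∷ P) (q ∷ Q) i)))) (go p q s)
  where
  r : ℕ
  r = ∑ (allFin n) (λ i → ind (free? P Q i))
  go : ∀ p q → p ∷ P ⊆ q ∷ Q → ∣ p ∷ P ∣ + (ind (free? (p ∷ P) (q ∷ Q) zero) + r) ≡ ∣ q ∷ Q ∣
  go true true s = cong suc (∣free∣ P Q (drop-∷-⊆ s))
  go false true s = trans (+-suc ∣ P ∣ r) (cong suc (∣free∣ P Q (drop-∷-⊆ s)))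
  go false false s = ∣free∣ P Q (drop-∷-⊆ s)
  go true false s with s here
  ... | ()

-- The dimension is a separate index tied by an equation, not a truncated difference, so that `∑ch`
-- can recurse on it.
gap : ∀ {n} → ℕ → Subset n → Subset n → Set
gap d P Q = P ⊆ Q × ∣ P ∣ + d ≡ ∣ Q ∣

length-free : ∀ {n d} (P Q : Subset n) → gap d P Q → ∑ (allFin n) (λ i → ind (free? P Q i)) ≡ d
length-free P Q (s , e) = +-cancelˡ-≡ ∣ P ∣ _ _ (trans (∣free∣ P Q s) (sym e))

gap-⊕ : ∀ {n d} {P Q : Subset n} {i} → gap (suc d) P Q → lookup P i ≡ false → lookup Q i ≡ true → gap d (P ⊕ i) Q
gap-⊕ {d = d} {P} {Q} {i} (s , e) p q = ⊕-⊆ s q , trans (cong (_+ d) (∣⊕∣ P i p)) (trans (sym (+-suc ∣ P ∣ d)) e)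

gap-⊖ : ∀ {n d} {P Q : Subset n} {i} → gap (suc d) P Q → lookup P i ≡ false → lookup Q i ≡ true → gap d P (Q ⊖ i)
gap-⊖ {d = d} {P} {Q} {i} (s , e) p q =
  ⊆-⊖ s p , suc-injective (trans (sym (+-suc ∣ P ∣ d)) (trans e (sym (∣⊖∣ Q i q))))

gap-∁ : ∀ {n d} {P Q : Subset n} → gap d P Q → gap d (∁ Q) (∁ P)
gap-∁ {n} {d} {P} {Q} (s , e) = p⊆q⇒∁p⊇∁q s , +-cancelˡ-≡ ∣ P ∣ _ _ (begin
  ∣ P ∣ + (∣ ∁ Q ∣ + d) ≡⟨ cong (∣ P ∣ +_) (+-comm ∣ ∁ Q ∣ d) ⟩
  ∣ P ∣ + (d + ∣ ∁ Q ∣) ≡⟨ sym (+-assoc ∣ P ∣ d _) ⟩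
  ∣ P ∣ + d + ∣ ∁ Q ∣ ≡⟨ cong (_+ ∣ ∁ Q ∣) e ⟩
  ∣ Q ∣ + ∣ ∁ Q ∣ ≡⟨ ∣∁∣ Q ⟩
  n ≡⟨ sym (∣∁∣ P) ⟩
  ∣ P ∣ + ∣ ∁ P ∣ ∎)
  where open ≡-Reasoning

gap-0 : ∀ {n} {P Q : Subset n} → gap 0 P Q → P ≡ Q
gap-0 {P = P} (s , e) = ⊆∧∣∣⇒≡ s (≤-reflexive (trans (sym e) (+-identityʳ ∣ P ∣)))

-- Sum over the maximal chains P = C₀ ⊂ ⋯ ⊂ C_d = Q, listed bottom to top; meaningful only under gap d P Q.
∑ch : ∀ {n} → ℕ → Subset n → Subset n → (List (Subset n) → ℕ) → ℕ
∑ch zero P Q f = f (P ∷ [])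
∑ch (suc d) P Q f = ∑ (free P Q) (λ i → ∑ch d (P ⊕ i) Q (λ c → f (P ∷ c)))

-- The lists produced by `∑ch` carry no proof. This predicate supplies it, so that `∑ch-mono` asks
-- for its inequality on genuine chains only.
data Chain {n} (Q : Subset n) : ℕ → Subset n → List (Subset n) → Set where
  stop : ∀ {P} → Chain Q 0 P (P ∷ [])
  step : ∀ {d P c} i → lookup P i ≡ false → lookup Q i ≡ true →
         Chain Q d (P ⊕ i) c → Chain Q (suc d) P (P ∷ c)

module _ {n : ℕ} where

  ∑ch-mono : ∀ d (P Q : Subset n) {f g} → (∀ c → Chain Q d P c → f c ≤ g c) → ∑ch d P Q f ≤ ∑ch d P Q g
  ∑ch-mono zero P Q e = e _ stop
  ∑ch-mono (suc d) P Q e = ∑-mono (free P Q) λ i i∈ →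
    ∑ch-mono d (P ⊕ i) Q λ c w → e (P ∷ c) (step i (proj₁ (∈-free⁻ P Q i∈)) (proj₂ (∈-free⁻ P Q i∈)) w)

  ∑ch-cong : ∀ d (P Q : Subset n) {f g} → (∀ c → f c ≡ g c) → ∑ch d P Q f ≡ ∑ch d P Q g
  ∑ch-cong zero P Q e = e _
  ∑ch-cong (suc d) P Q e = ∑-cong (free P Q) λ i → ∑ch-cong d (P ⊕ i) Q (λ c → e (P ∷ c))

  ∑ch-+ : ∀ d (P Q : Subset n) f g → ∑ch d P Q (λ c → f c + g c) ≡ ∑ch d P Q f + ∑ch d P Q g
  ∑ch-+ zero P Q f g = refl
  ∑ch-+ (suc d) P Q f g = trans (∑-cong (free P Q) λ i → ∑ch-+ d (P ⊕ i) Q _ _) (∑-+ (free P Q) _ _)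

  ∑ch-* : ∀ d (P Q : Subset n) k f → ∑ch d P Q (λ c → k * f c) ≡ k * ∑ch d P Q f
  ∑ch-* zero P Q k f = refl
  ∑ch-* (suc d) P Q k f = trans (∑-cong (free P Q) λ i → ∑ch-* d (P ⊕ i) Q k _) (∑-* (free P Q) k _)

  ∑ch-∑ : ∀ {A : Set} d (P Q : Subset n) (xs : List A) (f : A → List (Subset n) → ℕ) →
          ∑ch d P Q (λ c → ∑ xs (λ a → f a c)) ≡ ∑ xs (λ a → ∑ch d P Q (f a))
  ∑ch-∑ zero P Q xs f = refl
  ∑ch-∑ (suc d) P Q xs f = trans (∑-cong (free P Q) λ i → ∑ch-∑ d (P ⊕ i) Q xs _) (∑-swap (free P Q) xs _)

  ∑-free : ∀ (P Q : Subset n) f → ∑ (free P Q) f ≡ ∑ (allFin n) (λ i → ind (free? P Q i) * f i)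
  ∑-free P Q f = ∑-filter (free? P Q) (allFin n) f

  -- The range of the inner sum depends on i. Once both ranges are indicators over all of `Fin n`,
  -- the sums can be exchanged.
  ∑-free² : ∀ (P Q : Subset n) (P′ Q′ : Fin n → Subset n) (f : Fin n → Fin n → ℕ) →
    ∑ (free P Q) (λ i → ∑ (free (P′ i) (Q′ i)) (f i)) ≡
    ∑ (allFin n) (λ i → ∑ (allFin n) (λ j → ind (free? P Q i) * (ind (free? (P′ i) (Q′ i) j) * f i j)))
  ∑-free² P Q P′ Q′ f = trans (∑-free P Q _) (∑-cong (allFin n) λ i →
    trans (cong (ind (free? P Q i) *_) (∑-free (P′ i) (Q′ i) _)) (sym (∑-* (allFin n) (ind (free? P Q i)) _)))

  ∑ch-const : ∀ d (P Q : Subset n) k → gap d P Q → ∑ch d P Q (λ _ → k) ≡ d ! * k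
  ∑ch-const zero P Q k g = sym (*-identityˡ k)
  ∑ch-const (suc d) P Q k g = begin
    ∑ (free P Q) (λ i → ∑ch d (P ⊕ i) Q (λ _ → k))
      ≡⟨ ∑-cong∈ (free P Q) (λ i i∈ → ∑ch-const d (P ⊕ i) Q k (gap-⊕ g (proj₁ (∈-free⁻ P Q i∈)) (proj₂ (∈-free⁻ P Q i∈)))) ⟩
    ∑ (free P Q) (λ _ → d ! * k) ≡⟨ ∑-const (free P Q) _ ⟩
    length (free P Q) * (d ! * k)
      ≡⟨ cong (_* (d ! * k)) (trans (length-filter-ind (free? P Q) (allFin n)) (length-free P Q g)) ⟩
    suc d * (d ! * k) ≡⟨ sym (*-assoc (suc d) (d !) k) ⟩
    suc d ! * k ∎
    where open ≡-Reasoning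

  -- Either side says that i and j are distinct elements of Q - P: the second factor vanishes at i =
  -- j and is otherwise unaffected by the change.
  free-swap : ∀ (P Q : Subset n) i j →
    ind (free? P Q i) * ind (free? (P ⊕ i) Q j) ≡ ind (free? P Q j) * ind (free? P (Q ⊖ j) i)
  free-swap P Q i j with i ≟ᶠ j
  ... | yes refl rewrite lookup∘update i P true | lookup∘update i Q false
                 | ∧-comm (not (lookup P i)) false = trans (*-zeroʳ (ind (free? P Q i))) (sym (*-zeroʳ (ind (free? P Q i))))
  ... | no i≢j rewrite lookup∘update′ (i≢j ∘ sym) P true | lookup∘update′ i≢j Q false = *-comm (ind (free? P Q i)) _

  -- `∑ch` unfolds at the bottom, but complementation turns chains upside down, so an unfolding at
  -- the top is needed. The induction picks a bottom element i and then a top element j; `free-swap`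
  -- lets j come first.
  ∑ch-top : ∀ d (P Q : Subset n) f → gap (suc d) P Q →
            ∑ch (suc d) P Q f ≡ ∑ (free P Q) (λ j → ∑ch d P (Q ⊖ j) (λ c → f (c ∷ʳ Q)))
  ∑ch-top zero P Q f g = ∑-cong∈ (free P Q) λ i i∈ →
    cong (λ R → f (P ∷ R ∷ [])) (gap-0 (gap-⊕ g (proj₁ (∈-free⁻ P Q i∈)) (proj₂ (∈-free⁻ P Q i∈))))
  ∑ch-top (suc d) P Q f g = begin
    ∑ (free P Q) (λ i → ∑ch (suc d) (P ⊕ i) Q (λ c → f (P ∷ c)))
      ≡⟨ ∑-cong∈ (free P Q) (λ i i∈ → ∑ch-top d (P ⊕ i) Q (λ c → f (P ∷ c))
           (gap-⊕ g (proj₁ (∈-free⁻ P Q i∈)) (proj₂ (∈-free⁻ P Q i∈)))) ⟩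
    ∑ (free P Q) (λ i → ∑ (free (P ⊕ i) Q) (λ j → t i j))
      ≡⟨ ∑-free² P Q (λ i → P ⊕ i) (λ _ → Q) t ⟩
    ∑ (allFin n) (λ i → ∑ (allFin n) (λ j → ind (free? P Q i) * (ind (free? (P ⊕ i) Q j) * t i j)))
      ≡⟨ ∑-swap (allFin n) (allFin n) _ ⟩
    ∑ (allFin n) (λ j → ∑ (allFin n) (λ i → ind (free? P Q i) * (ind (free? (P ⊕ i) Q j) * t i j)))
      ≡⟨ ∑-cong (allFin n) (λ j → ∑-cong (allFin n) (λ i →
           trans (sym (*-assoc (ind (free? P Q i)) _ _))
                 (trans (cong (_* t i j) (free-swap P Q i j)) (*-assoc (ind (free? P Q j)) _ _)))) ⟩
    ∑ (allFin n) (λ j → ∑ (allFin n) (λ i → ind (free? P Q j) * (ind (free? P (Q ⊖ j) i) * t i j)))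
      ≡⟨ sym (∑-free² P Q (λ _ → P) (λ j → Q ⊖ j) (λ j i → t i j)) ⟩
    ∑ (free P Q) (λ j → ∑ (free P (Q ⊖ j)) (λ i → t i j)) ∎
    where
    open ≡-Reasoning
    t : Fin n → Fin n → ℕ
    t i j = ∑ch d (P ⊕ i) (Q ⊖ j) (λ c → f (P ∷ c ∷ʳ Q))

  dual : List (Subset n) → List (Subset n)
  dual [] = []
  dual (A ∷ c) = dual c ∷ʳ ∁ A

  free-∁ : ∀ (P Q : Subset n) i → isFree (∁ Q) (∁ P) i ≡ isFree P Q i
  free-∁ P Q i rewrite lookup-map i not P | lookup-map i not Q | not-involutive (lookup Q i) = ∧-comm (lookup Q i) _

  -- Removing j at the top of [P , Q] is adding j at the bottom of the complementary interval.
  ∑ch-dual : ∀ d (P Q : Subset n) f → gap d P Q →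
             ∑ch d P Q f ≡ ∑ch d (∁ Q) (∁ P) (λ c → f (dual c))
  ∑ch-dual zero P Q f g = cong (λ R → f (R ∷ [])) (trans (gap-0 g) (sym (∁∁ Q)))
  ∑ch-dual (suc d) P Q f g = begin
    ∑ch (suc d) P Q f ≡⟨ ∑ch-top d P Q f g ⟩
    ∑ (free P Q) (λ j → ∑ch d P (Q ⊖ j) (λ c → f (c ∷ʳ Q)))
      ≡⟨ ∑-cong∈ (free P Q) (λ j j∈ → trans
           (∑ch-dual d P (Q ⊖ j) (λ c → f (c ∷ʳ Q)) (gap-⊖ g (proj₁ (∈-free⁻ P Q j∈)) (proj₂ (∈-free⁻ P Q j∈))))
           (cong₂ (λ R S → ∑ch d R (∁ P) (λ c → f (dual c ∷ʳ S))) (∁⊖ Q j) (sym (∁∁ Q)))) ⟩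
    ∑ (free P Q) t ≡⟨ ∑-free P Q t ⟩
    ∑ (allFin n) (λ i → ind (free? P Q i) * t i)
      ≡⟨ ∑-cong (allFin n) (λ i → cong (λ b → ind (b ≟ᵇ true) * t i) (sym (free-∁ P Q i))) ⟩
    ∑ (allFin n) (λ i → ind (free? (∁ Q) (∁ P) i) * t i) ≡⟨ sym (∑-free (∁ Q) (∁ P) t) ⟩
    ∑ch (suc d) (∁ Q) (∁ P) (λ c → f (dual c)) ∎
    where
    open ≡-Reasoning
    t : Fin n → ℕ
    t j = ∑ch d (∁ Q ⊕ j) (∁ P) (λ c → f (dual c ∷ʳ ∁ (∁ Q)))

-- Counting the chains through a set

_∈?_ : ∀ {n} (x : Subset n) (xs : List (Subset n)) → Dec (x ∈ xs)
x ∈? xs = any? (x ≟ˢ_) xs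

infix 4 _⊏_ _⊏?_

_⊏_ : ∀ {n} → Subset n → Subset n → Set
A ⊏ B = A ⊆ B × ∣ A ∣ < ∣ B ∣

_⊏?_ : ∀ {n} (A B : Subset n) → Dec (A ⊏ B)
A ⊏? B = (A ⊆? B) ×-dec (∣ A ∣ <? ∣ B ∣)

⊏-trans : ∀ {n} {A B C : Subset n} → A ⊏ B → B ⊏ C → A ⊏ C
⊏-trans (p , l) (q , m) = ⊆-trans p q , <-trans l m

⊆∧≢⇒⊏ : ∀ {n} {A B : Subset n} → A ⊆ B → A ≢ B → A ⊏ B
⊆∧≢⇒⊏ {A = A} {B} s ne with ∣ A ∣ <? ∣ B ∣
... | yes l = s , l
... | no ¬l = ⊥-elim (ne (⊆∧∣∣⇒≡ s (≮⇒≥ ¬l)))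

⊏-⊕ : ∀ {n} (P : Subset n) i → lookup P i ≡ false → P ⊏ P ⊕ i
⊏-⊕ P i e = ⊆-⊕ P i , ≤-reflexive (sym (∣⊕∣ P i e))

gap-∸ : ∀ {n} {A B : Subset n} → A ⊆ B → gap (∣ B ∣ ∸ ∣ A ∣) A B
gap-∸ s = s , m+[n∸m]≡n (p⊆q⇒∣p∣≤∣q∣ s)

gap-+ : ∀ {n a b d} {P A Q : Subset n} → gap a P A → gap b A Q → gap d P Q → a + b ≡ d
gap-+ {a = a} {b} {d} {P} {A} {Q} (_ , e) (_ , e′) (_ , e″) =
  +-cancelˡ-≡ ∣ P ∣ _ _ (trans (sym (+-assoc ∣ P ∣ a b)) (trans (cong (_+ b) e) (trans e′ (sym e″))))

module _ {n : ℕ} where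

  occ : Subset n → List (Subset n) → ℕ
  occ A c = ∑ c (λ B → ind (B ≟ˢ A))

  cnt : List (Subset n) → List (Subset n) → ℕ
  cnt G c = ∑ c (λ B → ind (B ∈? G))

  ∑ch-occ-tail : ∀ d (P Q A : Subset n) → P ≢ A → ∑ch d P Q (occ A) ≡ ∑ch d P Q (occ A ∘ drop 1)
  ∑ch-occ-tail zero P Q A ne = cong (_+ 0) (ind-no (P ≟ˢ A) ne)
  ∑ch-occ-tail (suc d) P Q A ne =
    ∑-cong (free P Q) λ i → ∑ch-cong d (P ⊕ i) Q λ c → cong (_+ occ A c) (ind-no (P ≟ˢ A) ne)

  ∑ch-occ-⊈ : ∀ d (P Q A : Subset n) → ¬ P ⊆ A → ∑ch d P Q (occ A) ≡ 0
  ∑ch-occ-⊈ zero P Q A ns = cong (_+ 0) (ind-no (P ≟ˢ A) (λ { refl → ns id }))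
  ∑ch-occ-⊈ (suc d) P Q A ns = trans (∑ch-occ-tail (suc d) P Q A (λ { refl → ns id }))
    (∑-zero (free P Q) λ i _ → ∑ch-occ-⊈ d (P ⊕ i) Q A (λ s → ns (⊆-trans (⊆-⊕ P i) s)))

  ∑ch-tail-⊏̸ : ∀ d (P Q A : Subset n) → ¬ P ⊏ A → ∑ch d P Q (occ A ∘ drop 1) ≡ 0
  ∑ch-tail-⊏̸ zero P Q A ns = refl
  ∑ch-tail-⊏̸ (suc d) P Q A ns = ∑-zero (free P Q) λ i i∈ → ∑ch-occ-⊈ d (P ⊕ i) Q A λ s →
    ns (⊆-trans (⊆-⊕ P i) s , ≤-trans (proj₂ (⊏-⊕ P i (proj₁ (∈-free⁻ P Q i∈)))) (p⊆q⇒∣p∣≤∣q∣ s))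

  ∑ch-occ-outside : ∀ d (P Q A : Subset n) → gap d P Q → ¬ A ⊆ Q → ∑ch d P Q (occ A) ≡ 0
  ∑ch-occ-outside d P Q A g ns with P ≟ˢ A
  ... | yes refl = ⊥-elim (ns (proj₁ g))
  ∑ch-occ-outside zero P Q A g ns | no ne = ∑ch-occ-tail 0 P Q A ne
  ∑ch-occ-outside (suc d) P Q A g ns | no ne = trans (∑ch-occ-tail (suc d) P Q A ne)
    (∑-zero (free P Q) λ i i∈ → ∑ch-occ-outside d (P ⊕ i) Q A
      (gap-⊕ g (proj₁ (∈-free⁻ P Q i∈)) (proj₂ (∈-free⁻ P Q i∈))) ns)

  ∑ch-occ-self : ∀ d (A Q : Subset n) → gap d A Q → ∑ch d A Q (occ A) ≡ d !
  ∑ch-occ-self zero A Q g = cong (_+ 0) (ind-yes (A ≟ˢ A) refl)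
  ∑ch-occ-self (suc d) A Q g = begin
    ∑ (free A Q) (λ i → ∑ch d (A ⊕ i) Q (λ c → ind (A ≟ˢ A) + occ A c))
      ≡⟨ ∑-cong (free A Q) (λ i → trans (∑ch-cong d (A ⊕ i) Q (λ c → cong (_+ occ A c) (ind-yes (A ≟ˢ A) refl))) (∑ch-+ d (A ⊕ i) Q (λ _ → 1) _)) ⟩
    ∑ (free A Q) (λ i → ∑ch d (A ⊕ i) Q (λ _ → 1) + ∑ch d (A ⊕ i) Q (occ A)) ≡⟨ ∑-+ (free A Q) _ _ ⟩
    ∑ch (suc d) A Q (λ _ → 1) + ∑ch (suc d) A Q (occ A ∘ drop 1)
      ≡⟨ cong₂ _+_ (∑ch-const (suc d) A Q 1 g) (∑ch-tail-⊏̸ (suc d) A Q A (λ l → <-irrefl refl (proj₂ l))) ⟩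
    suc d ! * 1 + 0 ≡⟨ trans (+-identityʳ _) (*-identityʳ _) ⟩
    suc d ! ∎
    where open ≡-Reasoning

  -- The first step of a chain through A must add one of the a elements of A - P, and each leaves (a
  -- - 1)! b! chains; any other first step leads to a set not contained in A.
  ∑ch-occ : ∀ a b (P A Q : Subset n) → gap a P A → gap b A Q → ∑ch (a + b) P Q (occ A) ≡ a ! * b !
  ∑ch-occ zero b P A Q g g′ with gap-0 g
  ... | refl = trans (∑ch-occ-self b A Q g′) (sym (+-identityʳ _))
  ∑ch-occ (suc a) b P A Q g g′ = begin
    ∑ch (suc a + b) P Q (occ A) ≡⟨ ∑ch-occ-tail (suc a + b) P Q A P≢A ⟩
    ∑ (free P Q) (λ i → ∑ch (a + b) (P ⊕ i) Q (occ A)) ≡⟨ ∑-free P Q _ ⟩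
    ∑ (allFin n) (λ i → ind (free? P Q i) * ∑ch (a + b) (P ⊕ i) Q (occ A)) ≡⟨ ∑-cong (allFin n) pt ⟩
    ∑ (allFin n) (λ i → (a ! * b !) * ind (free? P A i)) ≡⟨ ∑-* (allFin n) (a ! * b !) _ ⟩
    (a ! * b !) * ∑ (allFin n) (λ i → ind (free? P A i)) ≡⟨ cong (a ! * b ! *_) (length-free P A g) ⟩
    (a ! * b !) * suc a ≡⟨ *-comm (a ! * b !) (suc a) ⟩
    suc a * (a ! * b !) ≡⟨ sym (*-assoc (suc a) (a !) (b !)) ⟩
    suc a ! * b ! ∎
    where
    open ≡-Reasoning
    P≢A : P ≢ A
    P≢A refl = m≢1+m+n ∣ P ∣ (trans (sym (proj₂ g)) (+-suc ∣ P ∣ a))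
    pt : ∀ i → ind (free? P Q i) * ∑ch (a + b) (P ⊕ i) Q (occ A) ≡ (a ! * b !) * ind (free? P A i)
    pt i with free? P A i
    ... | yes fA = let (p , q) = isFree⁻ P A i fA in
      trans (cong₂ _*_ (ind-yes (free? P Q i) (isFree⁺ P Q i p (⊆-lookup (proj₁ g′) i q)))
                       (∑ch-occ a b (P ⊕ i) A Q (gap-⊕ g p q) g′))
            (*-comm 1 (a ! * b !))
    ... | no nfA with free? P Q i
    ...   | no _ = sym (*-zeroʳ (a ! * b !))
    ...   | yes fQ = trans (trans (+-identityʳ _) (∑ch-occ-⊈ (a + b) (P ⊕ i) Q A λ s →
                       nfA (isFree⁺ P A i (proj₁ (isFree⁻ P Q i fQ)) (⊆-lookup s i (lookup∘update i P true)))))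
                     (sym (*-zeroʳ (a ! * b !)))

  wt : Subset n → Subset n → Subset n → ℕ
  wt P Q A = (∣ A ∣ ∸ ∣ P ∣) ! * (∣ Q ∣ ∸ ∣ A ∣) !

  within? : ∀ (P Q A : Subset n) → Dec (P ⊆ A × A ⊆ Q)
  within? P Q A = (P ⊆? A) ×-dec (A ⊆? Q)

  ∑ch-occ-wt : ∀ d (P Q A : Subset n) → gap d P Q → ∑ch d P Q (occ A) ≡ ind (within? P Q A) * wt P Q A
  ∑ch-occ-wt d P Q A g with P ⊆? A | A ⊆? Q
  ... | no ns | _ = ∑ch-occ-⊈ d P Q A ns
  ... | yes _ | no ns = ∑ch-occ-outside d P Q A g ns
  ... | yes s | yes s′ = trans (cong (λ k → ∑ch k P Q (occ A)) (sym (gap-+ (gap-∸ s) (gap-∸ s′) g)))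
                           (trans (∑ch-occ _ _ P A Q (gap-∸ s) (gap-∸ s′)) (sym (+-identityʳ _)))

  -- Membership becomes a sum over G, so that counting members along chains can be exchanged for
  -- counting chains through members. A repeated entry of G would be counted twice.
  mult : ∀ (G : List (Subset n)) → Unique G → ∀ B → ind (B ∈? G) ≡ ∑ G (λ A → ind (B ≟ˢ A))
  mult [] _ B = refl
  mult (A ∷ G) (A∉G ∷ u) B with B ≟ˢ A
  ... | yes refl = cong suc (sym (∑-zero G λ C C∈ → ind-no (B ≟ˢ C) (All.lookup A∉G C∈)))
  ... | no ne = trans (ind-cong {P = B ∈ A ∷ G} _ (B ∈? G) (λ { (here e) → ⊥-elim (ne e) ; (there p) → p }) there) (mult G u B)

  cnt-occ : ∀ (G : List (Subset n)) → Unique G → ∀ c → cnt G c ≡ ∑ G (λ A → occ A c)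
  cnt-occ G u c = trans (∑-cong c (mult G u)) (∑-swap c G _)

  ∑ch-cnt : ∀ d (P Q : Subset n) G → Unique G → gap d P Q →
            ∑ch d P Q (cnt G) ≡ ∑ G (λ A → ind (within? P Q A) * wt P Q A)
  ∑ch-cnt d P Q G u g = trans (∑ch-cong d P Q (cnt-occ G u)) (trans (∑ch-∑ d P Q G occ)
    (∑-cong G λ A → ∑ch-occ-wt d P Q A g))

  above? : ∀ (P Q A : Subset n) → Dec (P ⊏ A × A ⊆ Q)
  above? P Q A = (P ⊏? A) ×-dec (A ⊆? Q)

  ∑ch-cnt-tail : ∀ d (P Q : Subset n) G → Unique G → gap d P Q →
                 ∑ch d P Q (cnt G ∘ drop 1) ≡ ∑ (filter (above? P Q) G) (wt P Q)
  ∑ch-cnt-tail d P Q G u g = begin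
    ∑ch d P Q (cnt G ∘ drop 1) ≡⟨ ∑ch-cong d P Q (cnt-occ G u ∘ drop 1) ⟩
    ∑ch d P Q (λ c → ∑ G (λ A → occ A (drop 1 c))) ≡⟨ ∑ch-∑ d P Q G (λ A → occ A ∘ drop 1) ⟩
    ∑ G (λ A → ∑ch d P Q (occ A ∘ drop 1)) ≡⟨ ∑-cong G pt ⟩
    ∑ G (λ A → ind (above? P Q A) * wt P Q A) ≡⟨ sym (∑-filter (above? P Q) G (wt P Q)) ⟩
    ∑ (filter (above? P Q) G) (wt P Q) ∎
    where
    open ≡-Reasoning
    pt : ∀ A → ∑ch d P Q (occ A ∘ drop 1) ≡ ind (above? P Q A) * wt P Q A
    pt A with P ⊏? A
    ... | no ns = ∑ch-tail-⊏̸ d P Q A ns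
    ... | yes l = trans (sym (∑ch-occ-tail d P Q A λ { refl → <-irrefl refl (proj₂ l) }))
      (trans (∑ch-occ-wt d P Q A g) (cong (_* wt P Q A)
        (ind-cong (within? P Q A) (yes l ×-dec (A ⊆? Q)) (λ p → l , proj₂ p) (λ p → proj₁ l , proj₂ p))))

  -- Heights in F

  Ht : List (Subset n) → ℕ → Subset n → Set
  Ht F zero B = ⊤
  Ht F (suc k) B = Any (λ D → D ⊏ B × Ht F k D) F

  Ht? : ∀ F k B → Dec (Ht F k B)
  Ht? F zero B = yes tt
  Ht? F (suc k) B = any? (λ D → (D ⊏? B) ×-dec Ht? F k D) F

  Ht-suc : ∀ {F k B D} → D ∈ F → D ⊏ B → Ht F k D → Ht F (suc k) B
  Ht-suc {k = k} {B} D∈F D⊏B ht = Any.map (λ { refl → D⊏B , ht }) D∈F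

  -- The sets chosen one level at a time are glued into a single sequence, total on ℕ but meaningful
  -- only up to k.
  Ht-chain : ∀ F k B → B ∈ F → Ht F k B → ∃ λ (f : ℕ → Subset n) →
    f k ≡ B × (∀ i → i ≤ k → f i ∈ F) × (∀ i → i < k → f i ⊏ f (suc i))
  Ht-chain F zero B B∈F _ = (λ _ → B) , refl , (λ _ _ → B∈F) , (λ _ ())
  Ht-chain F (suc k) B B∈F ht with find ht
  ... | D , D∈F , D⊏B , htD with Ht-chain F k D D∈F htD
  ...   | f , fk , fm , fs = f′ , f′-top , f′-mem , f′-step
    where
    f′ : ℕ → Subset n
    f′ i with i ≤? k
    ... | yes _ = f i
    ... | no _ = B
    f′-top : f′ (suc k) ≡ B
    f′-top with suc k ≤? k
    ... | yes l = ⊥-elim (<-irrefl refl l)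
    ... | no _ = refl
    f′-mem : ∀ i → i ≤ suc k → f′ i ∈ F
    f′-mem i _ with i ≤? k
    ... | yes l = fm i l
    ... | no _ = B∈F
    f′-step : ∀ i → i < suc k → f′ i ⊏ f′ (suc i)
    f′-step i i<1+k with i ≤? k | suc i ≤? k
    ... | yes _ | yes l = fs i l
    ... | no ¬l | _ = ⊥-elim (¬l (s≤s⁻¹ i<1+k))
    ... | yes l | no ¬l = subst (λ j → f j ⊏ B) (sym i≡k) (subst (_⊏ B) (sym fk) D⊏B)
      where
      i≡k : i ≡ k
      i≡k = ≤-antisym l (≮⇒≥ ¬l)

  steps-⊆ : ∀ (f : ℕ → Subset n) k → (∀ i → i < k → f i ⊏ f (suc i)) → ∀ {i j} → i ≤ j → j ≤ k → f i ⊆ f j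
  steps-⊆ f k st {i} {zero} z≤n _ = id
  steps-⊆ f k st {i} {suc j} i≤1+j j<k with i ≟ suc j
  ... | yes refl = id
  ... | no ne = ⊆-trans (steps-⊆ f k st (s≤s⁻¹ (≤∧≢⇒< i≤1+j ne)) (<⇒≤ j<k)) (proj₁ (st j j<k))

  steps-< : ∀ (f : ℕ → Subset n) k → (∀ i → i < k → f i ⊏ f (suc i)) → ∀ {i j} → i < j → j ≤ k → ∣ f i ∣ < ∣ f j ∣
  steps-< f k st {i} {suc j} (s≤s i≤j) j<k =
    ≤-<-trans (p⊆q⇒∣p∣≤∣q∣ (steps-⊆ f k st i≤j (<⇒≤ j<k))) (proj₂ (st j j<k))

  steps-inj : ∀ (f : ℕ → Subset n) k → (∀ i → i < k → f i ⊏ f (suc i)) → ∀ {i j} → i ≤ k → j ≤ k → f i ≡ f j → i ≡ j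
  steps-inj f k st {i} {j} i≤k j≤k e with <-cmp i j
  ... | tri≈ _ eq _ = eq
  ... | tri< l _ _ = ⊥-elim (<-irrefl (cong ∣_∣ e) (steps-< f k st l j≤k))
  ... | tri> _ _ l = ⊥-elim (<-irrefl (cong ∣_∣ (sym e)) (steps-< f k st l i≤k))

-- Members of F above a high set

lookup-injective : ∀ {A : Set} {xs : List A} → Unique xs → ∀ i j → lookupᴸ xs i ≡ lookupᴸ xs j → i ≡ j
lookup-injective (_ ∷ _) zero zero e = refl
lookup-injective {xs = x ∷ xs} (p ∷ _) zero (suc j) e = ⊥-elim (All.lookup p (∈-lookup j) e)
lookup-injective {xs = x ∷ xs} (p ∷ _) (suc i) zero e = ⊥-elim (All.lookup p (∈-lookup i) (sym e))
lookup-injective (_ ∷ u) (suc i) (suc j) e = cong suc (lookup-injective u i j e)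

-- The chain topped by B provides the x's of a copy and the list ys its y's. As copies preserve
-- rank, this limits the sets of one size only.
few-above : ∀ {n h s} {F : List (Subset n)} → ¬ CopyY (suc h) s F → ∀ {B} → B ∈ F → Ht F h B →
            ∀ k (ys : List (Subset n)) → Unique ys → (∀ y → y ∈ ys → y ∈ F × B ⊏ y × ∣ y ∣ ≡ k) → length ys < s
few-above {n} {h} {s} {F} ¬copy {B} B∈F ht k ys u m with length ys <? s
... | yes l = l
... | no ¬l with Ht-chain F h B B∈F ht
...   | f , fh , fm , fs = ⊥-elim (¬copy record
  { X = λ i → f (toℕ i)
  ; Y = Y
  ; X∈ = λ i → fm (toℕ i) (i≤h i)
  ; Y∈ = λ j → proj₁ (mY j)
  ; X-inj = λ i i′ e → toℕ-injective (steps-inj f h fs (i≤h i) (i≤h i′) e)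
  ; Y-inj = λ j j′ e → inject≤-injective s≤ s≤ j j′ (lookup-injective u _ _ e)
  ; XY-dist = λ i j e → <-irrefl (cong ∣_∣ e) (≤-<-trans (p⊆q⇒∣p∣≤∣q∣ (X⊆B i)) (proj₂ (proj₁ (proj₂ (mY j)))))
  ; X-chain = λ i i′ l → steps-⊆ f h fs l (i≤h i′)
  ; X⊆Y = λ i j → ⊆-trans (X⊆B i) (proj₁ (proj₁ (proj₂ (mY j))))
  ; Y-rank = λ j j′ → trans (proj₂ (proj₂ (mY j))) (sym (proj₂ (proj₂ (mY j′))))
  })
  where
  s≤ : s ≤ length ys
  s≤ = ≮⇒≥ ¬l
  Y : Fin s → Subset n
  Y j = lookupᴸ ys (inject≤ j s≤)
  mY : ∀ j → Y j ∈ F × B ⊏ Y j × ∣ Y j ∣ ≡ k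
  mY j = m (Y j) (∈-lookup _)
  i≤h : ∀ (i : Fin (suc h)) → toℕ i ≤ h
  i≤h i = s≤s⁻¹ (toℕ<n i)
  X⊆B : ∀ i → f (toℕ i) ⊆ B
  X⊆B i = subst (f (toℕ i) ⊆_) fh (steps-⊆ f h fs (i≤h i) ≤-refl)

-- An upper bound, for 1 ≤ j ≤ r, on j! (2 + r - j)!, the number of maximal chains through a set at
-- height j of an interval of dimension 2 + r.
bnd : ℕ → ℕ → ℕ
bnd r 0 = 0
bnd r 1 = suc r !
bnd r (suc (suc _)) = 2 * r !

!*!-bound : ∀ a b → (2 + a) ! * (2 + b) ! ≤ 2 * (2 + a + b) !
!*!-bound zero b = ≤-refl
!*!-bound (suc a) b = begin
  ((3 + a) * (2 + a) !) * (2 + b) ! ≡⟨ *-assoc (3 + a) ((2 + a) !) _ ⟩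
  (3 + a) * ((2 + a) ! * (2 + b) !) ≤⟨ *-mono-≤ (m≤m+n (3 + a) b) (!*!-bound a b) ⟩
  (3 + a + b) * (2 * (2 + a + b) !) ≡⟨ swap (3 + a + b) 2 ((2 + a + b) !) ⟩
  2 * ((3 + a + b) * (2 + a + b) !) ∎
  where
  open ≤-Reasoning
  swap : ∀ x y z → x * (y * z) ≡ y * (x * z)
  swap = solve-∀

!*!≤bnd : ∀ j k r → 1 ≤ j → 2 ≤ k → j + k ≡ 2 + r → j ! * k ! ≤ bnd r j
!*!≤bnd 1 k r _ _ e rewrite suc-injective e = ≤-reflexive (+-identityʳ _)
!*!≤bnd (suc (suc a)) (suc (suc b)) r _ _ e = begin
  (2 + a) ! * (2 + b) ! ≤⟨ !*!-bound a b ⟩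
  2 * (2 + a + b) ! ≡⟨ cong (λ x → 2 * x !) (trans (sym (trans (+-suc a (suc b)) (cong suc (+-suc a b)))) (suc-injective (suc-injective e))) ⟩
  2 * r ! ∎
  where open ≤-Reasoning
!*!≤bnd (suc (suc a)) 1 r _ (s≤s ()) e

sumTo-bnd : ∀ r → sumTo (2 + r) (bnd r) ≤ 3 * suc r !
sumTo-bnd r = begin
  sumTo (2 + r) (bnd r) ≡⟨ sumTo-split 2 r (bnd r) ⟩
  suc r ! + sumTo r (λ _ → 2 * r !) ≡⟨ cong (suc r ! +_) (sumTo-const r _) ⟩
  suc r ! + r * (2 * r !) ≤⟨ +-monoʳ-≤ (suc r !) (*-monoˡ-≤ (2 * r !) (n≤1+n r)) ⟩
  suc r ! + suc r * (2 * r !) ≡⟨ ring (suc r) (r !) ⟩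
  3 * (suc r * r !) ∎
  where
  open ≤-Reasoning
  ring : ∀ x y → x * y + x * (2 * y) ≡ 3 * (x * y)
  ring = solve-∀

-- With at most s sets at each height, chains and members above B meet at most 3 s (q - 1)! times in
-- all, and 6 s ≤ q makes this at most half of q!. So the constant 6 is 2 · 3. The distance between
-- G and Q excludes Q itself, through which every chain runs, and the sets just below it.
half-above : ∀ {n h s} {F G : List (Subset n)} → ¬ CopyY (suc h) (suc s) F → Unique G → (∀ {A} → A ∈ G → A ∈ F) →
  ∀ {B Q q} → B ∈ F → Ht F h B → gap q B Q →
  (∀ {A} → A ∈ G → A ⊆ Q → ∣ A ∣ + 6 * suc s ≤ ∣ Q ∣) → 6 * suc s ≤ q →
  2 * ∑ch q B Q (cnt G ∘ drop 1) ≤ q !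
half-above {n} {h} {s} {F} {G} ¬copy uG G⊆F {B} {Q} {q} B∈F ht g far 6s≤q =
  aux q g 6s≤q
  where
  open ≤-Reasoning
  2≤6s : 2 ≤ 6 * suc s
  2≤6s = ≤-trans (s≤s (s≤s z≤n)) (*-monoʳ-≤ 6 {1} {suc s} (s≤s z≤n))
  ys : List (Subset n)
  ys = filter (above? B Q) G
  lev : Subset n → ℕ
  lev A = ∣ A ∣ ∸ ∣ B ∣
  ys⁻ : ∀ {A} → A ∈ ys → A ∈ G × B ⊏ A × A ⊆ Q
  ys⁻ = ∈-filter⁻ (above? B Q)
  count : ∀ k → ∑ ys (λ A → ind (lev A ≟ k)) ≤ s
  count k = s≤s⁻¹ (subst (_< suc s) (length-filter-ind (λ A → lev A ≟ k) ys)
    (few-above ¬copy B∈F ht (∣ B ∣ + k) (filter (λ A → lev A ≟ k) ys)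
      (Unique-filter⁺ (λ A → lev A ≟ k) (Unique-filter⁺ (above? B Q) uG))
      λ A A∈ → let (A∈ys , e) = ∈-filter⁻ (λ A → lev A ≟ k) {xs = ys} A∈
                   (A∈G , B⊏A , _) = ys⁻ A∈ys in
        G⊆F A∈G , B⊏A , sym (trans (cong (∣ B ∣ +_) (sym e)) (m+[n∸m]≡n (<⇒≤ (proj₂ B⊏A))))))
  aux : ∀ q → gap q B Q → 6 * suc s ≤ q → 2 * ∑ch q B Q (cnt G ∘ drop 1) ≤ q !
  aux zero g l with () ← ≤-trans 2≤6s l
  aux (suc zero) g l with s≤s () ← ≤-trans 2≤6s l
  aux (suc (suc r)) g l = begin
    2 * ∑ch (2 + r) B Q (cnt G ∘ drop 1) ≡⟨ cong (2 *_) (∑ch-cnt-tail (2 + r) B Q G uG g) ⟩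
    2 * ∑ ys (wt B Q) ≤⟨ *-monoʳ-≤ 2 (∑-mono ys λ A A∈ → let (_ , l , m , e) = facts A∈ in !*!≤bnd (lev A) (∣ Q ∣ ∸ ∣ A ∣) r l m e) ⟩
    2 * ∑ ys (λ A → bnd r (lev A)) ≡⟨ cong (2 *_) (∑-levels lev (bnd r) (2 + r) ys (λ A A∈ → proj₁ (facts A∈))) ⟩
    2 * sumTo (2 + r) (λ k → ∑ ys (λ A → ind (lev A ≟ k)) * bnd r k) ≤⟨ *-monoʳ-≤ 2 (sumTo-mono (2 + r) λ k _ → *-monoˡ-≤ (bnd r k) (count k)) ⟩
    2 * sumTo (2 + r) (λ k → s * bnd r k) ≡⟨ cong (2 *_) (sumTo-* (2 + r) s (bnd r)) ⟩
    2 * (s * sumTo (2 + r) (bnd r)) ≤⟨ *-monoʳ-≤ 2 (*-monoʳ-≤ s (sumTo-bnd r)) ⟩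
    2 * (s * (3 * suc r !)) ≡⟨ ring s (suc r !) ⟩
    (6 * s) * suc r ! ≤⟨ *-monoˡ-≤ (suc r !) (≤-trans (*-monoʳ-≤ 6 (n≤1+n s)) l) ⟩
    (2 + r) * suc r ! ∎
    where
    ring : ∀ x y → 2 * (x * (3 * y)) ≡ (6 * x) * y
    ring = solve-∀
    facts : ∀ {A} → A ∈ ys → lev A < 2 + r × 1 ≤ lev A × 2 ≤ ∣ Q ∣ ∸ ∣ A ∣ × lev A + (∣ Q ∣ ∸ ∣ A ∣) ≡ 2 + r
    facts {A} A∈ = lev< , m<n⇒0<n∸m (proj₂ B⊏A) , 2≤ , sum≡
      where
      A∈G : A ∈ G
      A∈G = proj₁ (ys⁻ A∈)
      B⊏A : B ⊏ A
      B⊏A = proj₁ (proj₂ (ys⁻ A∈))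
      A⊆Q : A ⊆ Q
      A⊆Q = proj₂ (proj₂ (ys⁻ A∈))
      2≤ : 2 ≤ ∣ Q ∣ ∸ ∣ A ∣
      2≤ = m+n≤o⇒m≤o∸n 2 (≤-trans (≤-trans (≤-reflexive (+-comm 2 ∣ A ∣)) (+-monoʳ-≤ ∣ A ∣ 2≤6s)) (far A∈G A⊆Q))
      sum≡ : lev A + (∣ Q ∣ ∸ ∣ A ∣) ≡ 2 + r
      sum≡ = gap-+ (gap-∸ (proj₁ B⊏A)) (gap-∸ A⊆Q) g
      lev< : lev A < 2 + r
      lev< = subst (lev A <_) sum≡ (m<m+n (lev A) (<-≤-trans (s≤s z≤n) 2≤))

-- Chains stopped at their first element satisfying W

module _ {n : ℕ} {W : Subset n → Set} (W? : ∀ B → Dec (W B)) (G : List (Subset n)) where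

  hit : List (Subset n) → ℕ
  hit [] = 0
  hit (B ∷ c) with W? B
  ... | yes _ = 1
  ... | no _ = hit c

  after : List (Subset n) → ℕ
  after [] = 0
  after (B ∷ c) with W? B
  ... | yes _ = cnt G c
  ... | no _ = after c

  hit≤1 : ∀ c → hit c ≤ 1
  hit≤1 [] = z≤n
  hit≤1 (B ∷ c) with W? B
  ... | yes _ = ≤-refl
  ... | no _ = hit≤1 c

  hit-yes : ∀ {B c} → W B → hit (B ∷ c) ≡ 1
  hit-yes {B} w with W? B
  ... | yes _ = refl
  ... | no ¬w = ⊥-elim (¬w w)

  hit-no : ∀ {B c} → ¬ W B → hit (B ∷ c) ≡ hit c
  hit-no {B} ¬w with W? B
  ... | yes w = ⊥-elim (¬w w)
  ... | no _ = refl

  after-yes : ∀ {B c} → W B → after (B ∷ c) ≡ cnt G c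
  after-yes {B} w with W? B
  ... | yes _ = refl
  ... | no ¬w = ⊥-elim (¬w w)

  after-no : ∀ {B c} → ¬ W B → after (B ∷ c) ≡ after c
  after-no {B} ¬w with W? B
  ... | yes w = ⊥-elim (¬w w)
  ... | no _ = refl

  -- Chains are grouped by their first set B in W. Stopping at the first such set puts no condition
  -- on the part above B, which runs over all maximal chains of [B , Q], so `half` applies to each
  -- group.
  ∑-after≤∑-hit : ∀ {Q} → (∀ {B q} → W B → gap q B Q → 2 * ∑ch q B Q (cnt G ∘ drop 1) ≤ q !) →
    ∀ d P → gap d P Q → 2 * ∑ch d P Q after ≤ ∑ch d P Q hit
  ∑-after≤∑-hit {Q} half d P g with W? P
  ... | yes w = begin
    2 * ∑ch d P Q after ≤⟨ *-monoʳ-≤ 2 (∑ch-mono d P Q λ { _ stop → ≤-reflexive (after-yes w) ; _ (step i _ _ _) → ≤-reflexive (after-yes w) }) ⟩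
    2 * ∑ch d P Q (cnt G ∘ drop 1) ≤⟨ half w g ⟩
    d ! ≡⟨ trans (sym (*-identityʳ (d !))) (sym (∑ch-const d P Q 1 g)) ⟩
    ∑ch d P Q (λ _ → 1) ≤⟨ ∑ch-mono d P Q (λ { _ stop → ≤-reflexive (sym (hit-yes w)) ; _ (step i _ _ _) → ≤-reflexive (sym (hit-yes w)) }) ⟩
    ∑ch d P Q hit ∎
    where open ≤-Reasoning
  ∑-after≤∑-hit {Q} half zero P g | no ¬w = subst (λ x → 2 * x ≤ hit (P ∷ [])) (sym (after-no ¬w)) z≤n
  ∑-after≤∑-hit {Q} half (suc d) P g | no ¬w = begin
    2 * ∑ (free P Q) (λ i → ∑ch d (P ⊕ i) Q (λ c → after (P ∷ c)))
      ≡⟨ sym (∑-* (free P Q) 2 _) ⟩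
    ∑ (free P Q) (λ i → 2 * ∑ch d (P ⊕ i) Q (λ c → after (P ∷ c)))
      ≡⟨ ∑-cong (free P Q) (λ i → cong (2 *_) (∑ch-cong d (P ⊕ i) Q (λ c → after-no ¬w))) ⟩
    ∑ (free P Q) (λ i → 2 * ∑ch d (P ⊕ i) Q after)
      ≤⟨ ∑-mono (free P Q) (λ i i∈ → ∑-after≤∑-hit half d (P ⊕ i) (gap-⊕ g (proj₁ (∈-free⁻ P Q i∈)) (proj₂ (∈-free⁻ P Q i∈)))) ⟩
    ∑ (free P Q) (λ i → ∑ch d (P ⊕ i) Q hit)
      ≡⟨ ∑-cong (free P Q) (λ i → ∑ch-cong d (P ⊕ i) Q (λ c → sym (hit-no ¬w))) ⟩
    ∑ (free P Q) (λ i → ∑ch d (P ⊕ i) Q (λ c → hit (P ∷ c))) ∎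
    where open ≤-Reasoning

-- High sets on a chain

Top : ∀ {n} → List (Subset n) → Subset n → Set
Top F B = Any (B ⊏_) F

-- Requiring Top makes W empty on a chain that meets F in h sets which extend to no longer chain of F;
-- such chains have nothing to pay for a hit.
W : ∀ {n} (F G : List (Subset n)) (h : ℕ) → Subset n → Set
W F G h B = B ∈ G × Ht F h B × Top F B

W? : ∀ {n} (F G : List (Subset n)) h B → Dec (W F G h B)
W? F G h B = (B ∈? G) ×-dec (Ht? F h B ×-dec any? (B ⊏?_) F)

hitW afterW : ∀ {n} (F G : List (Subset n)) (h : ℕ) → List (Subset n) → ℕ
hitW F G h = hit (W? F G h) G
afterW F G h = after (W? F G h) G

Chain-⊏ : ∀ {n d c} {P Q R : Subset n} → P ⊏ R → Chain Q d R c → All (P ⊏_) c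
Chain-⊏ l stop = l ∷ []
Chain-⊏ {R = R} l (step i p q w) = l ∷ Chain-⊏ (⊏-trans l (⊏-⊕ R i p)) w

Chain-increasing : ∀ {n d c} {P Q : Subset n} → Chain Q d P c → AllPairs _⊏_ c
Chain-increasing stop = [] ∷ []
Chain-increasing {P = P} (step i p q w) = Chain-⊏ (⊏-⊕ P i p) w ∷ Chain-increasing w

Chain-⊆ : ∀ {n d c} {P Q : Subset n} → Chain Q d P c → All (P ⊆_) c
Chain-⊆ stop = id ∷ []
Chain-⊆ {P = P} (step i p q w) = id ∷ All.map proj₁ (Chain-⊏ (⊏-⊕ P i p) w)

cnt-pos : ∀ {n} (G c : List (Subset n)) → 0 < cnt G c → ∃ λ D → D ∈ c × D ∈ G
cnt-pos G (B ∷ c) l with B ∈? G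
... | yes B∈G = B , here refl , B∈G
... | no _ = let (D , D∈c , D∈G) = cnt-pos G c l in D , there D∈c , D∈G

cnt-zero : ∀ {n} (G c : List (Subset n)) → cnt G c ≡ 0 → ∀ {D} → D ∈ c → ¬ D ∈ G
cnt-zero G (B ∷ c) e (here refl) D∈G = 1+n≢0 (trans (sym (ind-yes (B ∈? G) D∈G)) (m+n≡0⇒m≡0 _ e))
cnt-zero G (B ∷ c) e (there D∈c) D∈G = cnt-zero G c (m+n≡0⇒n≡0 (ind (B ∈? G)) e) D∈c D∈G

module _ {n : ℕ} (F G : List (Subset n)) (G⊆F : ∀ {A} → A ∈ G → A ∈ F) (h : ℕ) where

  -- As long as the chain has not met W, every further member of G on it is one level higher in F.
  cnt≤after : ∀ t r c → r + t ≡ h → AllPairs _⊏_ c → (∀ {B} → B ∈ c → B ∈ G → Ht F r B) →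
              2 + t ≤ cnt G c → cnt G c ≤ afterW F G h c + suc t
  cnt≤after t r (B ∷ c) e (B⊏ ∷ inc) ht l with W? F G h B
  ... | yes w = begin
    ind (B ∈? G) + cnt G c ≤⟨ +-monoˡ-≤ (cnt G c) (ind≤1 (B ∈? G)) ⟩
    1 + cnt G c ≡⟨ +-comm 1 (cnt G c) ⟩
    cnt G c + 1 ≤⟨ +-monoʳ-≤ (cnt G c) (s≤s z≤n) ⟩
    cnt G c + suc t ∎
    where open ≤-Reasoning
  ... | no ¬w with B ∈? G
  ...   | no _ = cnt≤after t r c e inc (ht ∘ there) l
  -- With t = 0 the set B has height h. At least two members are left, not just one, so a member
  -- above B provides the `Top` part of W, against `¬w`.
  cnt≤after zero r (B ∷ c) e (B⊏ ∷ inc) ht l | no ¬w | yes B∈G =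
    let (D , D∈c , D∈G) = cnt-pos G c (s≤s⁻¹ l)
        r≡h = trans (sym (+-identityʳ r)) e
    in ⊥-elim (¬w (B∈G , subst (λ k → Ht F k B) r≡h (ht (here refl) B∈G) ,
         Any.map (λ { refl → All.lookup B⊏ D∈c }) (G⊆F D∈G)))
  cnt≤after (suc t) r (B ∷ c) e (B⊏ ∷ inc) ht l | no ¬w | yes B∈G =
    ≤-trans (s≤s (cnt≤after t (suc r) c (trans (sym (+-suc r t)) e) inc
               (λ D∈c D∈G → Ht-suc (G⊆F B∈G) (All.lookup B⊏ D∈c) (ht (here refl) B∈G)) (s≤s⁻¹ l)))
            (≤-reflexive (sym (+-suc (afterW F G h c) (suc t))))

  hit-last : ∀ c → AllPairs _⊏_ c → afterW F G h c ≡ 0 →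
             hitW F G h c ≡ 0 ⊎ ∃ λ B → B ∈ c × W F G h B × (∀ {A} → A ∈ c → A ∈ G → A ⊆ B)
  hit-last [] _ _ = inj₁ refl
  hit-last (B ∷ c) (B⊏ ∷ inc) e with W? F G h B
  ... | yes w = inj₂ (B , here refl , w , λ { (here refl) _ → id ; (there A∈c) A∈G → ⊥-elim (cnt-zero G c e A∈c A∈G) })
  ... | no _ with hit-last c inc e
  ...   | inj₁ z = inj₁ z
  ...   | inj₂ (D , D∈c , w , m) = inj₂ (D , there D∈c , w ,
            λ { (here refl) _ → proj₁ (All.lookup B⊏ D∈c) ; (there A∈c) A∈G → m A∈c A∈G })

-- Complements exchange Y with Y′ and high sets with low ones

map∁∁ : ∀ {n} (F : List (Subset n)) → map ∁ (map ∁ F) ≡ F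
map∁∁ F = trans (sym (map-∘ F)) (trans (map-cong ∁∁ F) (map-id F))

∈-∁⁻ : ∀ {n} {F : List (Subset n)} {A} → A ∈ map ∁ F → ∁ A ∈ F
∈-∁⁻ A∈ with ∈-map⁻ ∁ A∈
... | B , B∈F , refl = subst (_∈ _) (sym (∁∁ B)) B∈F

∈-∁⁺ : ∀ {n} {F : List (Subset n)} {A} → ∁ A ∈ F → A ∈ map ∁ F
∈-∁⁺ {A = A} ∁A∈ = subst (_∈ _) (∁∁ A) (∈-map⁺ ∁ ∁A∈)

⊏-∁ : ∀ {n} {A B : Subset n} → A ⊏ B → ∁ B ⊏ ∁ A
⊏-∁ {n} {A} {B} (s , l) = p⊆q⇒∁p⊇∁q s , +-cancelˡ-< ∣ A ∣ _ _ (begin-strict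
  ∣ A ∣ + ∣ ∁ B ∣ <⟨ +-monoˡ-< ∣ ∁ B ∣ l ⟩
  ∣ B ∣ + ∣ ∁ B ∣ ≡⟨ trans (∣∁∣ B) (sym (∣∁∣ A)) ⟩
  ∣ A ∣ + ∣ ∁ A ∣ ∎)
  where open ≤-Reasoning

∈-dual : ∀ {n} (c : List (Subset n)) {A} → A ∈ dual c → ∁ A ∈ c
∈-dual (B ∷ c) A∈ with ∈-++⁻ (dual c) A∈
... | inj₁ p = there (∈-dual c p)
... | inj₂ (here refl) = here (∁∁ B)

dual-∷ʳ : ∀ {n} (c : List (Subset n)) A → dual (c ∷ʳ A) ≡ ∁ A ∷ dual c
dual-∷ʳ [] A = refl
dual-∷ʳ (B ∷ c) A = cong (_∷ʳ ∁ B) (dual-∷ʳ c A)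

dual-dual : ∀ {n} (c : List (Subset n)) → dual (dual c) ≡ c
dual-dual [] = refl
dual-dual (A ∷ c) = trans (dual-∷ʳ (dual c) (∁ A)) (cong₂ _∷_ (∁∁ A) (dual-dual c))

dual-increasing : ∀ {n} {c : List (Subset n)} → AllPairs _⊏_ c → AllPairs _⊏_ (dual c)
dual-increasing [] = []
dual-increasing {c = A ∷ c} (A⊏ ∷ inc) = AllPairs-++⁺ (dual-increasing inc) ([] ∷ [])
  (All.tabulate λ {B} B∈ → subst (_⊏ ∁ A) (∁∁ B) (⊏-∁ (All.lookup A⊏ (∈-dual c B∈))) ∷ [])

cnt-dual : ∀ {n} (G c : List (Subset n)) → cnt (map ∁ G) (dual c) ≡ cnt G c
cnt-dual G [] = refl
cnt-dual G (A ∷ c) = trans (∑-++ (dual c) (∁ A ∷ []) _) (trans (+-comm (cnt (map ∁ G) (dual c)) _)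
  (cong₂ _+_ (trans (+-identityʳ _) (ind-cong (∁ A ∈? map ∁ G) (A ∈? G) (λ p → subst (_∈ G) (∁∁ A) (∈-∁⁻ p)) (∈-map⁺ ∁)))
             (cnt-dual G c)))

CopyY-∁ : ∀ {n h s} {F : List (Subset n)} → CopyY h s (map ∁ F) → CopyY' h s F
CopyY-∁ C = record
  { X = ∁ ∘ X ; Y = ∁ ∘ Y
  ; X∈ = ∈-∁⁻ ∘ X∈ ; Y∈ = ∈-∁⁻ ∘ Y∈
  ; X-inj = λ i i′ e → X-inj i i′ (∁-inj e) ; Y-inj = λ i i′ e → Y-inj i i′ (∁-inj e)
  ; XY-dist = λ i j e → XY-dist i j (∁-inj e)
  ; X-chain = λ i i′ l → p⊆q⇒∁p⊇∁q (X-chain i i′ l)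
  ; Y⊆X = λ i j → p⊆q⇒∁p⊇∁q (X⊆Y i j)
  ; Y-rank = λ j j′ → +-cancelˡ-≡ ∣ Y j ∣ _ _ (trans (∣∁∣ (Y j)) (trans (sym (∣∁∣ (Y j′))) (cong (_+ ∣ ∁ (Y j′) ∣) (Y-rank j′ j))))
  }
  where open CopyY C

CopyY'-∁ : ∀ {n h s} {F : List (Subset n)} → CopyY' h s (map ∁ F) → CopyY h s F
CopyY'-∁ C = record
  { X = ∁ ∘ X ; Y = ∁ ∘ Y
  ; X∈ = ∈-∁⁻ ∘ X∈ ; Y∈ = ∈-∁⁻ ∘ Y∈
  ; X-inj = λ i i′ e → X-inj i i′ (∁-inj e) ; Y-inj = λ i i′ e → Y-inj i i′ (∁-inj e)
  ; XY-dist = λ i j e → XY-dist i j (∁-inj e)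
  ; X-chain = λ i i′ l → p⊆q⇒∁p⊇∁q (X-chain i i′ l)
  ; X⊆Y = λ i j → p⊆q⇒∁p⊇∁q (Y⊆X i j)
  ; Y-rank = λ j j′ → +-cancelˡ-≡ ∣ Y j ∣ _ _ (trans (∣∁∣ (Y j)) (trans (sym (∣∁∣ (Y j′))) (cong (_+ ∣ ∁ (Y j′) ∣) (Y-rank j′ j))))
  }
  where open CopyY' C

-- Anything in F above the last member of G on c lies, after complementation, below the whole dual chain,
-- which raises all heights there by one.
hit⇒after-dual : ∀ {n} (F G c F′ G′ c′ : List (Subset n)) → (∀ {A} → A ∈ G → A ∈ F) →
  F′ ≡ map ∁ F → G′ ≡ map ∁ G → c′ ≡ dual c → AllPairs _⊏_ c → ∀ h →
  2 + h ≤ cnt G c → afterW F G (suc h) c ≡ 0 → afterW F′ G′ (suc h) c′ ≡ 0 → hitW F G (suc h) c ≡ 0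
hit⇒after-dual F G c F′ G′ c′ G⊆F refl refl refl inc h l a0 a0′ with hit-last F G G⊆F (suc h) c inc a0
... | inj₁ z = z
... | inj₂ (B , B∈c , (_ , _ , top) , m) with find top
...   | D , D∈F , B⊏D = ⊥-elim (<-irrefl refl (begin-strict
  suc h <⟨ l ⟩
  cnt G c ≡⟨ sym (cnt-dual G c) ⟩
  cnt G′ c′ ≤⟨ cnt≤after F′ G′ G′⊆F′ (suc h) h 1 c′ refl (dual-increasing inc)
                (λ A∈ A∈G′ → Ht-suc {k = 0} (∈-map⁺ ∁ D∈F) (below A∈ A∈G′) tt) (≤-trans l (≤-reflexive (sym (cnt-dual G c)))) ⟩
  afterW F′ G′ (suc h) c′ + suc h ≡⟨ cong (_+ suc h) a0′ ⟩
  suc h ∎))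
  where
  open ≤-Reasoning
  G′⊆F′ : ∀ {A} → A ∈ map ∁ G → A ∈ map ∁ F
  G′⊆F′ A∈ = ∈-∁⁺ (G⊆F (∈-∁⁻ A∈))
  below : ∀ {A} → A ∈ dual c → A ∈ map ∁ G → ∁ D ⊏ A
  below {A} A∈ A∈G′ = subst (∁ D ⊏_) (∁∁ A)
    (let (s , l) = ⊏-∁ B⊏D ; t = p⊆q⇒∁p⊇∁q (m (∈-dual c A∈) (∈-∁⁻ A∈G′)) in ⊆-trans s t , <-≤-trans l (p⊆q⇒∣p∣≤∣q∣ t))

-- The average number of members on a chain

-- Here b and b′ mark the hits from either side, and a and a′ count what follows them. Below H the
-- slack 2 pays for both marks; above H, 2a + 2a′ ≥ 4 (k - H) ≥ 2 (k - H) + 2; at H a positive a or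
-- a′ pays 2, and otherwise there are no marks.
pointwise-arith : ∀ H k b b′ a a′ → b ≤ 1 → b′ ≤ 1 →
  (H < k → k ≤ a + H) → (H < k → k ≤ a′ + H) → (k ≡ H → a ≡ 0 → a′ ≡ 0 → b ≡ 0 × b′ ≡ 0) →
  (2 * k + b′) + b ≤ (2 * H + 2 * a′) + 2 * a
pointwise-arith H k b b′ a a′ b≤1 b′≤1 p p′ q with <-cmp k H
... | tri< k<H _ _ = begin
  (2 * k + b′) + b ≤⟨ +-mono-≤ (+-monoʳ-≤ (2 * k) b′≤1) b≤1 ⟩
  (2 * k + 1) + 1 ≡⟨ ring k ⟩
  2 * suc k ≤⟨ *-monoʳ-≤ 2 k<H ⟩
  2 * H ≤⟨ ≤-trans (m≤m+n _ (2 * a′)) (m≤m+n _ (2 * a)) ⟩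
  (2 * H + 2 * a′) + 2 * a ∎
  where
  open ≤-Reasoning
  ring : ∀ k → (2 * k + 1) + 1 ≡ 2 * suc k
  ring = solve-∀
... | tri> _ _ H<k = +-cancelʳ-≤ (2 * H) _ _ (begin
  ((2 * k + b′) + b) + 2 * H ≤⟨ +-monoˡ-≤ (2 * H) (+-mono-≤ (+-monoʳ-≤ (2 * k) b′≤1) b≤1) ⟩
  ((2 * k + 1) + 1) + 2 * H ≡⟨ ring k H ⟩
  2 * k + 2 * suc H ≤⟨ +-monoʳ-≤ (2 * k) (*-monoʳ-≤ 2 H<k) ⟩
  2 * k + 2 * k ≤⟨ +-mono-≤ (*-monoʳ-≤ 2 (p H<k)) (*-monoʳ-≤ 2 (p′ H<k)) ⟩
  2 * (a + H) + 2 * (a′ + H) ≡⟨ ring′ a a′ H ⟩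
  ((2 * H + 2 * a′) + 2 * a) + 2 * H ∎)
  where
  open ≤-Reasoning
  ring : ∀ k H → ((2 * k + 1) + 1) + 2 * H ≡ 2 * k + 2 * suc H
  ring = solve-∀
  ring′ : ∀ a a′ H → 2 * (a + H) + 2 * (a′ + H) ≡ ((2 * H + 2 * a′) + 2 * a) + 2 * H
  ring′ = solve-∀
pointwise-arith H k b b′ zero zero b≤1 b′≤1 p p′ q | tri≈ _ refl _ with q refl refl refl
... | refl , refl = ≤-refl
pointwise-arith H k b b′ (suc a) a′ b≤1 b′≤1 p p′ q | tri≈ _ refl _ = begin
  (2 * k + b′) + b ≤⟨ +-mono-≤ (+-monoʳ-≤ (2 * k) b′≤1) b≤1 ⟩
  (2 * k + 1) + 1 ≤⟨ m≤m+n _ (2 * a + 2 * a′) ⟩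
  ((2 * k + 1) + 1) + (2 * a + 2 * a′) ≡⟨ ring k a a′ ⟩
  (2 * k + 2 * a′) + 2 * suc a ∎
  where
  open ≤-Reasoning
  ring : ∀ k a a′ → ((2 * k + 1) + 1) + (2 * a + 2 * a′) ≡ (2 * k + 2 * a′) + 2 * suc a
  ring = solve-∀
pointwise-arith H k b b′ zero (suc a′) b≤1 b′≤1 p p′ q | tri≈ _ refl _ = begin
  (2 * k + b′) + b ≤⟨ +-mono-≤ (+-monoʳ-≤ (2 * k) b′≤1) b≤1 ⟩
  (2 * k + 1) + 1 ≤⟨ m≤m+n _ (2 * a′) ⟩
  ((2 * k + 1) + 1) + 2 * a′ ≡⟨ ring k a′ ⟩
  (2 * k + 2 * suc a′) + 0 ∎
  where
  open ≤-Reasoning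
  ring : ∀ k a′ → ((2 * k + 1) + 1) + 2 * a′ ≡ (2 * k + 2 * suc a′) + 0
  ring = solve-∀

module _ {n h s : ℕ} {F : List (Subset n)} (¬Y : ¬ CopyY (2 + h) (suc s) F) where

  private
    T : ℕ
    T = 6 * suc s

  ∑-afterW : ∀ {G} → Unique G → (∀ {A} → A ∈ G → A ∈ F) → ∀ {d P Q} → gap d P Q →
    (∀ {A} → A ∈ G → ∣ A ∣ + T ≤ ∣ Q ∣) →
    2 * ∑ch d P Q (afterW F G (suc h)) ≤ ∑ch d P Q (hitW F G (suc h))
  ∑-afterW {G} uG G⊆F {d} {P} {Q} g far = ∑-after≤∑-hit (W? F G (suc h)) G
    (λ { {B} {q} (B∈G , ht , _) g′ → half-above ¬Y uG G⊆F (G⊆F B∈G) ht g′ (λ A∈ _ → far A∈)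
           (+-cancelˡ-≤ ∣ B ∣ _ _ (≤-trans (far B∈G) (≤-reflexive (sym (proj₂ g′))))) })
    d P g

  -- E lies below every member of G on these chains, so heights start at 1 and only `suc h` members
  -- are free of charge. The excess comes after a first high set and costs at most 1/2 on average:
  -- half a set less than `2 + h` in total.
  ∑ch-cnt-bottom : ∀ {G} → Unique G → (∀ {A} → A ∈ G → A ∈ F) → ∀ {d E Q} → gap d E Q → E ∈ F →
    (∀ {A} → A ∈ G → ∣ E ∣ < ∣ A ∣) → (∀ {A} → A ∈ G → ∣ A ∣ + T ≤ ∣ Q ∣) →
    2 * ∑ch d E Q (cnt G) ≤ (3 + 2 * h) * d !
  ∑ch-cnt-bottom {G} uG G⊆F {d} {E} {Q} g E∈F big far = begin
    2 * ∑ch d E Q (cnt G) ≤⟨ *-monoʳ-≤ 2 (∑ch-mono d E Q pt) ⟩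
    2 * ∑ch d E Q (λ c → afterW F G (suc h) c + suc h) ≡⟨ cong (2 *_) (∑ch-+ d E Q _ _) ⟩
    2 * (∑ch d E Q (afterW F G (suc h)) + ∑ch d E Q (λ _ → suc h)) ≡⟨ *-distribˡ-+ 2 (∑ch d E Q (afterW F G (suc h))) _ ⟩
    2 * ∑ch d E Q (afterW F G (suc h)) + 2 * ∑ch d E Q (λ _ → suc h)
      ≤⟨ +-mono-≤ (∑-afterW uG G⊆F g far) (≤-reflexive (cong (2 *_) (∑ch-const d E Q (suc h) g))) ⟩
    ∑ch d E Q (hitW F G (suc h)) + 2 * (d ! * suc h)
      ≤⟨ +-monoˡ-≤ _ (∑ch-mono d E Q (λ c _ → hit≤1 (W? F G (suc h)) G c)) ⟩
    ∑ch d E Q (λ _ → 1) + 2 * (d ! * suc h) ≡⟨ cong (_+ 2 * (d ! * suc h)) (∑ch-const d E Q 1 g) ⟩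
    d ! * 1 + 2 * (d ! * suc h) ≡⟨ ring (d !) h ⟩
    (3 + 2 * h) * d ! ∎
    where
    open ≤-Reasoning
    ring : ∀ x h → x * 1 + 2 * (x * suc h) ≡ (3 + 2 * h) * x
    ring = solve-∀
    pt : ∀ c → Chain Q d E c → cnt G c ≤ afterW F G (suc h) c + suc h
    pt c w with 2 + h ≤? cnt G c
    ... | yes l = cnt≤after F G G⊆F (suc h) h 1 c refl (Chain-increasing w)
                    (λ A∈c A∈G → Ht-suc {k = 0} E∈F (All.lookup (Chain-⊆ w) A∈c , big A∈G) tt) l
    ... | no ¬l = ≤-trans (s≤s⁻¹ (≰⇒> ¬l)) (m≤n+m (suc h) _)

-- `pointwise-arith` is summed over all chains. By `∑-afterW`, used for F and, on the complementary
-- interval, for the complements, the terms for members after a hit are at most the hit sums on the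
-- left, and both cancel.
∑ch-cnt-≤ : ∀ {n h s} {F : List (Subset n)} → ¬ CopyY (2 + h) (suc s) F → ¬ CopyY' (2 + h) (suc s) F →
  ∀ {G} → Unique G → (∀ {A} → A ∈ G → A ∈ F) → ∀ {d P Q} → gap d P Q →
  (∀ {A} → A ∈ G → ∣ P ∣ + 6 * suc s ≤ ∣ A ∣) → (∀ {A} → A ∈ G → ∣ A ∣ + 6 * suc s ≤ ∣ Q ∣) →
  ∑ch d P Q (cnt G) ≤ (2 + h) * d !
∑ch-cnt-≤ {n} {h} {s} {F} ¬Y ¬Y' {G} uG G⊆F {d} {P} {Q} g far′ far = *-cancelˡ-≤ 2 (+-cancelʳ-≤ hs _ _ (+-cancelʳ-≤ hs′ _ _ (begin
  (2 * ∑ch d P Q (cnt G) + hs) + hs′ ≡⟨ +-comm3 (2 * ∑ch d P Q (cnt G)) hs hs′ ⟩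
  (2 * ∑ch d P Q (cnt G) + hs′) + hs
    ≡⟨ sym (trans (∑ch-+ d P Q _ _) (cong (_+ hs) (trans (∑ch-+ d P Q _ _) (cong (_+ hs′) (∑ch-* d P Q 2 _))))) ⟩
  ∑ch d P Q (λ c → (2 * cnt G c + hitW F′ G′ (suc h) (dual c)) + hitW F G (suc h) c) ≤⟨ ∑ch-mono d P Q pt ⟩
  ∑ch d P Q (λ c → (2 * (2 + h) + 2 * afterW F′ G′ (suc h) (dual c)) + 2 * afterW F G (suc h) c)
    ≡⟨ trans (∑ch-+ d P Q _ _) (cong₂ _+_ (trans (∑ch-+ d P Q _ _)
         (cong₂ _+_ (∑ch-const d P Q (2 * (2 + h)) g) (∑ch-* d P Q 2 _))) (∑ch-* d P Q 2 _)) ⟩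
  (d ! * (2 * (2 + h)) + 2 * ∑ch d P Q (afterW F′ G′ (suc h) ∘ dual)) + 2 * ∑ch d P Q (afterW F G (suc h))
    ≤⟨ +-mono-≤ (+-monoʳ-≤ (d ! * (2 * (2 + h))) dual-≤) (∑-afterW ¬Y uG G⊆F g far) ⟩
  (d ! * (2 * (2 + h)) + hs′) + hs ≡⟨ +-comm3 (d ! * (2 * (2 + h))) hs′ hs ⟩
  (d ! * (2 * (2 + h)) + hs) + hs′ ≡⟨ cong (λ x → (x + hs) + hs′) (ring (d !) (2 + h)) ⟩
  (2 * ((2 + h) * d !) + hs) + hs′ ∎)))
  where
  open ≤-Reasoning
  +-comm3 : ∀ x y z → (x + y) + z ≡ (x + z) + y
  +-comm3 = solve-∀
  ring : ∀ x y → x * (2 * y) ≡ 2 * (y * x)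
  ring = solve-∀
  F′ G′ : List (Subset n)
  F′ = map ∁ F
  G′ = map ∁ G
  G′⊆F′ : ∀ {A} → A ∈ G′ → A ∈ F′
  G′⊆F′ A∈ = ∈-∁⁺ (G⊆F (∈-∁⁻ A∈))
  hs hs′ : ℕ
  hs = ∑ch d P Q (hitW F G (suc h))
  hs′ = ∑ch d P Q (hitW F′ G′ (suc h) ∘ dual)
  pt : ∀ c → Chain Q d P c → (2 * cnt G c + hitW F′ G′ (suc h) (dual c)) + hitW F G (suc h) c
       ≤ (2 * (2 + h) + 2 * afterW F′ G′ (suc h) (dual c)) + 2 * afterW F G (suc h) c
  pt c w = pointwise-arith (2 + h) (cnt G c) _ _ _ _ (hit≤1 (W? F G (suc h)) G c) (hit≤1 (W? F′ G′ (suc h)) G′ (dual c))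
    (λ l → cnt≤after F G G⊆F (suc h) (suc h) 0 c refl inc (λ _ _ → tt) l)
    (λ l → subst (_≤ afterW F′ G′ (suc h) (dual c) + (2 + h)) (cnt-dual G c)
             (cnt≤after F′ G′ G′⊆F′ (suc h) (suc h) 0 (dual c) refl (dual-increasing inc) (λ _ _ → tt)
               (≤-trans l (≤-reflexive (sym (cnt-dual G c))))))
    (λ e a a′ →
      hit⇒after-dual F G c F′ G′ (dual c) G⊆F refl refl refl inc h (≤-reflexive (sym e)) a a′ ,
      hit⇒after-dual F′ G′ (dual c) F G c G′⊆F′ (sym (map∁∁ F)) (sym (map∁∁ G)) (sym (dual-dual c))
        (dual-increasing inc) h (≤-reflexive (sym (trans (cnt-dual G c) e))) a′ a)
    where
    inc : AllPairs _⊏_ c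
    inc = Chain-increasing w
  dual-sum : ∀ f → ∑ch d (∁ Q) (∁ P) f ≡ ∑ch d P Q (f ∘ dual)
  dual-sum f = trans (∑ch-dual d (∁ Q) (∁ P) f (gap-∁ g))
                     (cong₂ (λ R S → ∑ch d R S (f ∘ dual)) (∁∁ P) (∁∁ Q))
  dual-≤ : 2 * ∑ch d P Q (afterW F′ G′ (suc h) ∘ dual) ≤ hs′
  dual-≤ = subst₂ (λ x y → 2 * x ≤ y) (dual-sum _) (dual-sum _)
    (∑-afterW (¬Y' ∘ CopyY-∁) (Unique-map⁺ ∁-inj uG) G′⊆F′ (gap-∁ g) farDual)
    where
    farDual : ∀ {A} → A ∈ G′ → ∣ A ∣ + 6 * suc s ≤ ∣ ∁ P ∣
    farDual {A} A∈ = +-cancelˡ-≤ ∣ P ∣ _ _ (begin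
      ∣ P ∣ + (∣ A ∣ + 6 * suc s) ≡⟨ ring′ ∣ P ∣ ∣ A ∣ (6 * suc s) ⟩
      (∣ P ∣ + 6 * suc s) + ∣ A ∣ ≤⟨ +-monoˡ-≤ ∣ A ∣ (far′ (∈-∁⁻ A∈)) ⟩
      ∣ ∁ A ∣ + ∣ A ∣ ≡⟨ trans (+-comm ∣ ∁ A ∣ _) (trans (∣∁∣ A) (sym (∣∁∣ P))) ⟩
      ∣ P ∣ + ∣ ∁ P ∣ ∎)
      where
      ring′ : ∀ x y z → x + (y + z) ≡ (x + z) + y
      ring′ = solve-∀

-- Binomial coefficients near the middle and far from it

-- Indexed by the sizes of both parts, which keeps truncated subtraction out of the factorial
-- identities.
bin : ℕ → ℕ → ℕ
bin a b = (a + b) C a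

bin-! : ∀ a b → bin a b * (a ! * b !) ≡ (a + b) !
bin-! a b = begin
  bin a b * (a ! * b !) ≡⟨ cong (λ x → bin a b * (a ! * x !)) (sym (m+n∸m≡n a b)) ⟩
  bin a b * (a ! * (a + b ∸ a) !) ≡⟨ cong (_* (a ! * (a + b ∸ a) !)) (nCk≡n!/k![n-k]! (m≤m+n a b)) ⟩
  ((a + b) ! / (a ! * (a + b ∸ a) !)) {{nz}} * (a ! * (a + b ∸ a) !) ≡⟨ m/n*n≡m {{nz}} (k![n∸k]!∣n! (m≤m+n a b)) ⟩
  (a + b) ! ∎
  where
  open ≡-Reasoning
  nz : NonZero (a ! * (a + b ∸ a) !)
  nz = a !* (a + b ∸ a) !≢0

bin-sym : ∀ a b → bin a b ≡ bin b a
bin-sym a b = trans (nCk≡nC[n∸k] (m≤m+n a b)) (trans (cong ((a + b) C_) (m+n∸m≡n a b)) (cong (_C b) (+-comm a b)))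

bin-step : ∀ a b → bin (suc a) b * suc a ≡ bin a (suc b) * suc b
bin-step a b = *-cancelʳ-≡ _ _ (a ! * b !) {{a !* b !≢0}} (begin
  bin (suc a) b * suc a * (a ! * b !) ≡⟨ ring (bin (suc a) b) (suc a) (a !) (b !) ⟩
  bin (suc a) b * ((suc a * a !) * b !) ≡⟨ bin-! (suc a) b ⟩
  (suc a + b) ! ≡⟨ cong _! (sym (+-suc a b)) ⟩
  (a + suc b) ! ≡⟨ sym (bin-! a (suc b)) ⟩
  bin a (suc b) * (a ! * (suc b * b !)) ≡⟨ ring′ (bin a (suc b)) (suc b) (a !) (b !) ⟩
  bin a (suc b) * suc b * (a ! * b !) ∎)
  where
  open ≡-Reasoning
  ring : ∀ x y z w → x * y * (z * w) ≡ x * ((y * z) * w)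
  ring = solve-∀
  ring′ : ∀ x y z w → x * (z * (y * w)) ≡ x * y * (z * w)
  ring′ = solve-∀

bin-mono-step : ∀ a b → a ≤ b → bin a (suc b) ≤ bin (suc a) b
bin-mono-step a b a≤b = *-cancelʳ-≤ _ _ (suc b) (begin
  bin a (suc b) * suc b ≡⟨ sym (bin-step a b) ⟩
  bin (suc a) b * suc a ≤⟨ *-monoʳ-≤ (bin (suc a) b) (s≤s a≤b) ⟩
  bin (suc a) b * suc b ∎)
  where open ≤-Reasoning

bin-mono : ∀ j e r → e ≤ r → bin j (j + (e + r)) ≤ bin (j + e) (j + r)
bin-mono j zero r _ = ≤-reflexive (cong (λ x → bin x (j + r)) (sym (+-identityʳ j)))
bin-mono j (suc e) r e<r = begin
  bin j (j + (suc e + r)) ≡⟨ cong (λ x → bin j (j + x)) (sym (+-suc e r)) ⟩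
  bin j (j + (e + suc r)) ≤⟨ bin-mono j e (suc r) (m≤n⇒m≤1+n (<⇒≤ e<r)) ⟩
  bin (j + e) (j + suc r) ≡⟨ cong (bin (j + e)) (+-suc j r) ⟩
  bin (j + e) (suc (j + r)) ≤⟨ bin-mono-step (j + e) (j + r) (+-monoʳ-≤ j (<⇒≤ e<r)) ⟩
  bin (suc (j + e)) (j + r) ≡⟨ cong (λ x → bin x (j + r)) (sym (+-suc j e)) ⟩
  bin (j + suc e) (j + r) ∎
  where open ≤-Reasoning

-- With n = 2j + e + r the index moves from j to j + e. If e > r it passes the middle, and symmetry
-- replaces the target by j + r.
bin-unimodal : ∀ j e r → bin j (j + (e + r)) ≤ bin (j + e) (j + r)
bin-unimodal j e r with ≤-total e r
... | inj₁ e≤r = bin-mono j e r e≤r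
... | inj₂ r≤e = subst₂ _≤_ (cong (λ x → bin j (j + x)) (+-comm r e)) (bin-sym (j + r) (j + e)) (bin-mono j r e r≤e)

C-unimodal : ∀ n j k → j ≤ k → j + k ≤ n → n C j ≤ n C k
C-unimodal n j k j≤k j+k≤n with m≤n⇒∃[o]m+o≡n j≤k | m≤n⇒∃[o]m+o≡n j+k≤n
... | e , refl | r , refl = subst₂ _≤_
  (cong (_C j) (ring j e r)) (cong (_C (j + e)) (ring′ j e r)) (bin-unimodal j e r)
  where
  ring : ∀ j e r → j + (j + (e + r)) ≡ j + (j + e) + r
  ring = solve-∀
  ring′ : ∀ j e r → j + e + (j + r) ≡ j + (j + e) + r
  ring′ = solve-∀

central : ℕ → ℕ
central m = m C ⌊ m /2⌋

C≤central : ∀ m j → m C j ≤ central m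
C≤central m j with j ≤? ⌊ m /2⌋
... | yes l = C-unimodal m j ⌊ m /2⌋ l (≤-trans (+-monoˡ-≤ ⌊ m /2⌋ l)
                (≤-trans (+-monoʳ-≤ ⌊ m /2⌋ (⌊n/2⌋≤⌈n/2⌉ m)) (≤-reflexive (⌊n/2⌋+⌈n/2⌉≡n m))))
... | no ¬l with j ≤? m
...   | no ¬j≤m = ≤-trans (≤-reflexive (k>n⇒nCk≡0 (≰⇒> ¬j≤m))) z≤n
...   | yes j≤m = subst (_≤ central m) (sym (nCk≡nC[n∸k] j≤m)) (C-unimodal m (m ∸ j) ⌊ m /2⌋ l
                    (≤-trans (+-monoʳ-≤ (m ∸ j) (<⇒≤ (≰⇒> ¬l))) (≤-reflexive (m∸n+n≡m j≤m))))
  where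
  l : m ∸ j ≤ ⌊ m /2⌋
  l = m≤n+o⇒m∸n≤o m j (begin
    m ≡⟨ sym (⌊n/2⌋+⌈n/2⌉≡n m) ⟩
    ⌊ m /2⌋ + ⌈ m /2⌉ ≤⟨ +-monoʳ-≤ ⌊ m /2⌋ (⌊n/2⌋-mono (n≤1+n (suc m))) ⟩
    ⌊ m /2⌋ + suc ⌊ m /2⌋ ≡⟨ +-suc ⌊ m /2⌋ ⌊ m /2⌋ ⟩
    suc ⌊ m /2⌋ + ⌊ m /2⌋ ≤⟨ +-monoˡ-≤ ⌊ m /2⌋ (≰⇒> ¬l) ⟩
    j + ⌊ m /2⌋ ∎)
    where open ≤-Reasoning

central≤bin : ∀ a b → a ≤ b → b ≤ suc a → central (a + b) ≤ bin a b
central≤bin a b a≤b b≤1+a = C-unimodal (a + b) p a p≤a (≤-trans (≤-reflexive (+-comm p a)) (+-monoʳ-≤ a (≤-trans p≤a a≤b)))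
  where
  p : ℕ
  p = ⌊ a + b /2⌋
  p≤a : p ≤ a
  p≤a = ≤-trans (⌊n/2⌋-mono (+-monoʳ-≤ a b≤1+a)) (≤-reflexive (half a))
    where
    half : ∀ a → ⌊ a + suc a /2⌋ ≡ a
    half zero = refl
    half (suc a) rewrite +-suc a (suc a) = cong suc (half a)

-- The smaller coefficient is (a + 1)/(b + 1) times the larger, and the hypothesis makes this ratio
-- at least 1 - 1/M.
bin-flat-step : ∀ M a b → M * suc b ≤ M * suc a + suc b →
                M * bin (suc a) b ≤ M * bin a (suc b) + bin (suc a) b
bin-flat-step M a b l = *-cancelʳ-≤ _ _ (suc b) (begin
  M * x * suc b ≡⟨ ring M x (suc b) ⟩
  x * (M * suc b) ≤⟨ *-monoʳ-≤ x l ⟩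
  x * (M * suc a + suc b) ≡⟨ ring′ M x (suc a) (suc b) ⟩
  M * (x * suc a) + x * suc b ≡⟨ cong (λ z → M * z + x * suc b) (bin-step a b) ⟩
  M * (y * suc b) + x * suc b ≡⟨ ring″ M y (suc b) x ⟩
  (M * y + x) * suc b ∎)
  where
  open ≤-Reasoning
  x y : ℕ
  x = bin (suc a) b
  y = bin a (suc b)
  ring : ∀ M x b → M * x * b ≡ x * (M * b)
  ring = solve-∀
  ring′ : ∀ M x a b → x * (M * a + b) ≡ M * (x * a) + x * b
  ring′ = solve-∀
  ring″ : ∀ M y b x → M * (y * b) + x * b ≡ (M * y + x) * b
  ring″ = solve-∀

-- At most D steps from (a , b) to (a + 1 , b - 1) lead to the middle, and each costs at most one
-- M-th of the central coefficient.
bin-flat : ∀ M D a b → a ≤ b → b ≤ a + D → M * D ≤ b →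
           M * central (a + b) ≤ M * bin a b + D * central (a + b)
bin-flat M D a b a≤b b≤a+D l with b ≤? suc a
... | yes b≤1+a = ≤-trans (*-monoʳ-≤ M (central≤bin a b a≤b b≤1+a)) (m≤m+n _ _)
bin-flat M zero a b a≤b b≤a+D l | no ¬b = ⊥-elim (¬b (≤-trans b≤a+D (≤-trans (≤-reflexive (+-identityʳ a)) (n≤1+n a))))
bin-flat M (suc D) a zero a≤b b≤a+D l | no ¬b = ⊥-elim (¬b z≤n)
bin-flat zero (suc D) a (suc b) a≤b b≤a+D l | no ¬b = z≤n
bin-flat M@(suc M′) (suc D) a (suc b) a≤b b≤a+D l | no ¬b = begin
  M * c ≡⟨ cong (λ x → M * central x) (+-suc a b) ⟩
  M * central (suc a + b) ≤⟨ bin-flat M D (suc a) b a<b (≤-trans (s≤s⁻¹ (≤-trans b≤a+D (≤-reflexive (+-suc a D)))) (n≤1+n (a + D))) l′ ⟩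
  M * bin (suc a) b + D * central (suc a + b)
    ≤⟨ +-monoˡ-≤ _ (bin-flat-step M a b ratio) ⟩
  M * bin a (suc b) + bin (suc a) b + D * central (suc a + b)
    ≤⟨ +-monoˡ-≤ (D * central (suc a + b)) (+-monoʳ-≤ (M * bin a (suc b)) (C≤central (suc a + b) (suc a))) ⟩
  M * bin a (suc b) + central (suc a + b) + D * central (suc a + b) ≡⟨ +-assoc (M * bin a (suc b)) (central (suc a + b)) _ ⟩
  M * bin a (suc b) + suc D * central (suc a + b) ≡⟨ cong (λ x → M * bin a (suc b) + suc D * central x) (sym (+-suc a b)) ⟩
  M * bin a (suc b) + suc D * c ∎
  where
  open ≤-Reasoning
  c : ℕ
  c = central (a + suc b)
  a<b : suc a ≤ b
  a<b = s≤s⁻¹ (≰⇒> ¬b)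
  l′ : M * D ≤ b
  l′ = s≤s⁻¹ (≤-trans (≤-trans (s≤s (m≤n+m (M * D) M′)) (≤-reflexive (sym (*-suc M D)))) l)
  ratio : M * suc b ≤ M * suc a + suc b
  ratio = begin
    M * suc b ≤⟨ *-monoʳ-≤ M b≤a+D ⟩
    M * (a + suc D) ≡⟨ *-distribˡ-+ M a (suc D) ⟩
    M * a + M * suc D ≤⟨ +-mono-≤ (*-monoʳ-≤ M (n≤1+n a)) l ⟩
    M * suc a + suc b ∎

-- Uses M (D + 1) in place of M, so that the losses of D + 1 steps add up to a single M-th.
bin-flat-scaled : ∀ M D k l → k ≤ l → l ≤ k + suc D → 2 * (M * suc D * suc D) ≤ k + l →
                  M * central (k + l) ≤ M * bin k l + central (k + l)
bin-flat-scaled M D k l k≤l l≤ big = *-cancelʳ-≤ _ _ (suc D) (begin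
  M * c * suc D ≡⟨ ring M c (suc D) ⟩
  M * suc D * c ≤⟨ bin-flat (M * suc D) (suc D) k l k≤l l≤ (*-cancelˡ-≤ 2 (≤-trans big k+l≤2l)) ⟩
  M * suc D * bin k l + suc D * c ≡⟨ ring′ M (bin k l) c (suc D) ⟩
  (M * bin k l + c) * suc D ∎)
  where
  open ≤-Reasoning
  c : ℕ
  c = central (k + l)
  k+l≤2l : k + l ≤ 2 * l
  k+l≤2l = ≤-trans (+-monoˡ-≤ l k≤l) (≤-reflexive (cong (l +_) (sym (+-identityʳ l))))
  ring : ∀ M c d → M * c * d ≡ M * d * c
  ring = solve-∀
  ring′ : ∀ M b c d → M * d * b + d * c ≡ (M * b + c) * d
  ring′ = solve-∀

bin-flat-sym : ∀ M D k l → k ≤ l + suc D → l ≤ k + suc D → 2 * (M * suc D * suc D) ≤ k + l →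
               M * central (k + l) ≤ M * bin k l + central (k + l)
bin-flat-sym M D k l k≤ l≤ big with ≤-total k l
... | inj₁ k≤l = bin-flat-scaled M D k l k≤l l≤ big
... | inj₂ l≤k = subst₂ (λ x y → M * central x ≤ M * y + central x) (+-comm l k) (bin-sym l k)
  (bin-flat-scaled M D l k l≤k k≤ (≤-trans big (≤-reflexive (+-comm k l))))

central-suc≤ : ∀ m → central (suc m) ≤ 2 * central m
central-suc≤ m = go ⌊ suc m /2⌋
  where
  go : ∀ j → suc m C j ≤ 2 * central m
  go zero = ≤-trans (≤-trans (C≤central m 0) (m≤m+n _ _)) ≤-refl
  go (suc j) = ≤-trans (≤-reflexive (sym (nCk+nC[k+1]≡[n+1]C[k+1] m j)))
    (+-mono-≤ (C≤central m j) (≤-trans (C≤central m (suc j)) (≤-reflexive (sym (+-identityʳ _)))))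

-- By Pascal's rule C(m + 1 , p + 1) = C(m , p) + C(m , p + 1) with p = ⌊ m /2⌋; the first term is
-- central and the second nearly so by flatness.
central-double : ∀ M m → 2 * (M * 2 * 2) ≤ m → 1 ≤ m → M * (2 * central m) ≤ M * central (suc m) + central m
central-double M m big 1≤m = begin
  M * (2 * central m) ≡⟨ ring M (central m) ⟩
  M * central m + M * central m ≤⟨ +-monoʳ-≤ (M * central m) flat ⟩
  M * central m + (M * (m C suc p) + central m) ≡⟨ ring′ M (central m) (m C suc p) ⟩
  M * (m C p + m C suc p) + central m ≡⟨ cong (λ x → M * x + central m) (nCk+nC[k+1]≡[n+1]C[k+1] m p) ⟩
  M * (suc m C suc p) + central m ≤⟨ +-monoˡ-≤ (central m) (*-monoʳ-≤ M (C≤central (suc m) (suc p))) ⟩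
  M * central (suc m) + central m ∎
  where
  open ≤-Reasoning
  p q : ℕ
  p = ⌊ m /2⌋
  q = ⌈ m /2⌉
  ring : ∀ M c → M * (2 * c) ≡ M * c + M * c
  ring = solve-∀
  ring′ : ∀ M c x → M * c + (M * x + c) ≡ M * (c + x) + c
  ring′ = solve-∀
  flat : M * central m ≤ M * (m C suc p) + central m
  flat = aux q (⌊n/2⌋≤⌈n/2⌉ m) (⌊n/2⌋-mono (n≤1+n (suc m))) (⌊n/2⌋+⌈n/2⌉≡n m)
    where
    aux : ∀ q → p ≤ q → q ≤ suc p → p + q ≡ m → M * central m ≤ M * (m C suc p) + central m
    aux zero p≤q _ e with () ← ≤-trans 1≤m (≤-trans (≤-reflexive (sym e)) (+-monoˡ-≤ 0 p≤q))
    aux (suc q) p≤q q≤p e = subst (λ x → M * central x ≤ M * (x C suc p) + central x) (trans (sym (+-suc p q)) e)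
      (bin-flat-sym M 1 (suc p) q (≤-trans (s≤s p≤q) (≤-reflexive (+-comm 2 q))) (≤-trans (s≤s⁻¹ q≤p) (≤-trans (n≤1+n p) (m≤m+n (suc p) 2)))
        (≤-trans big (≤-reflexive (trans (sym e) (+-suc p q)))))

-- C(n , k + 1) is (n - k)/(k + 1) ≥ R times C(n , k).
C-growth : ∀ R n k → R * suc k + k ≤ n → R * (n C k) ≤ central n
C-growth R n k l with m≤n⇒∃[o]m+o≡n (≤-trans (m≤n+m k (R * suc k)) l)
... | zero , refl with R
...   | zero = z≤n
...   | suc R′ = ⊥-elim (m+1+n≰m k (≤-trans (≤-reflexive (+-comm k _)) (≤-trans l (≤-reflexive (+-identityʳ k)))))
C-growth R n k l | suc b , refl = ≤-trans (*-cancelʳ-≤ _ _ (suc k) (begin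
  R * bin k (suc b) * suc k ≡⟨ ring R (bin k (suc b)) (suc k) ⟩
  bin k (suc b) * (R * suc k) ≤⟨ *-monoʳ-≤ (bin k (suc b)) (+-cancelʳ-≤ k _ _ (≤-trans l (≤-reflexive (+-comm k (suc b))))) ⟩
  bin k (suc b) * suc b ≡⟨ sym (bin-step k b) ⟩
  bin (suc k) b * suc k ∎))
  (≤-trans (C≤central (suc k + b) (suc k)) (≤-reflexive (cong central (sym (+-suc k b)))))
  where
  open ≤-Reasoning
  ring : ∀ R x k → R * x * k ≡ x * (R * k)
  ring = solve-∀

-- Bounds twice the number of sets in [P , full], an interval of dimension m, when P lies t elements below a
-- member of F: splitting along an element of E − P leaves an ordinary interval and one with smaller t.
cubeBound : ℕ → ℕ → ℕ → ℕ
cubeBound h zero m = (3 + 2 * h) * central m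
cubeBound h (suc t) zero = 0
cubeBound h (suc t) (suc m) = 2 * ((2 + h) * central m) + cubeBound h t m

-- The deficit against 2 (2 + h) central coefficients is a fraction 1/4^t of one. Each split costs a
-- factor 4: a factor 2 because the central coefficient nearly doubles with the dimension, and
-- another to absorb the error of that doubling.
cubeBound-gap : ∀ h t → ∃ λ N → ∀ m → N ≤ m →
  4 ^ t * cubeBound h t m + central m ≤ 2 * (2 + h) * 4 ^ t * central m
cubeBound-gap h zero = 0 , λ m _ → ≤-reflexive (ring h (central m))
  where
  ring : ∀ h c → 1 * ((3 + 2 * h) * c) + c ≡ 2 * (2 + h) * 1 * c
  ring = solve-∀
cubeBound-gap h (suc t) with cubeBound-gap h t
... | N , bound = suc (N + (1 + 2 * (M * 2 * 2))) , go
  where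
  open ≤-Reasoning
  K M : ℕ
  K = 4 ^ t
  M = 2 * (2 + h) * (4 * K)
  go : ∀ m → suc (N + (1 + 2 * (M * 2 * 2))) ≤ m →
       4 ^ suc t * cubeBound h (suc t) m + central m ≤ 2 * (2 + h) * 4 ^ suc t * central m
  go (suc m) (s≤s l) = +-cancelʳ-≤ c′ _ _ (begin
    4 * K * (2 * (H * c′) + D) + c + c′ ≤⟨ +-monoˡ-≤ c′ (+-monoʳ-≤ (4 * K * (2 * (H * c′) + D)) (central-suc≤ m)) ⟩
    4 * K * (2 * (H * c′) + D) + 2 * c′ + c′ ≤⟨ m≤m+n _ c′ ⟩
    4 * K * (2 * (H * c′) + D) + 2 * c′ + c′ + c′ ≡⟨ ring K H c′ D ⟩
    8 * K * (H * c′) + 4 * (K * D + c′) ≤⟨ +-monoʳ-≤ (8 * K * (H * c′)) (*-monoʳ-≤ 4 (bound m (≤-trans (m≤m+n N _) l))) ⟩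
    8 * K * (H * c′) + 4 * (2 * H * K * c′) ≡⟨ ring′ K H c′ ⟩
    M * (2 * c′) ≤⟨ central-double M m (≤-trans (≤-trans (n≤1+n _) (m≤n+m _ N)) l) (≤-trans (≤-trans (s≤s z≤n) (m≤n+m _ N)) l) ⟩
    M * c + c′ ∎)
    where
    c c′ D H : ℕ
    H = 2 + h
    c = central (suc m)
    c′ = central m
    D = cubeBound h t m
    ring : ∀ K H c D → 4 * K * (2 * (H * c) + D) + 2 * c + c + c ≡ 8 * K * (H * c) + 4 * (K * D + c)
    ring = solve-∀
    ring′ : ∀ K H c → 8 * K * (H * c) + 4 * (2 * H * K * c) ≡ 2 * H * (4 * K) * (2 * c)
    ring′ = solve-∀

-- The threshold depends on the size t of the small member, but only finitely many sizes have to be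
-- served.
uniform : ∀ {P : ℕ → ℕ → Set} → (∀ t → ∃ λ N → ∀ n → N ≤ n → P t n) →
          ∀ T → ∃ λ N → ∀ t → t < T → ∀ n → N ≤ n → P t n
uniform p zero = 0 , λ _ ()
uniform {P} p (suc T) with uniform p T | p T
... | N , f | N′ , f′ = N + N′ , g
  where
  g : ∀ t → t < suc T → ∀ n → N + N′ ≤ n → P t n
  g t t<1+T n l with t ≟ T
  ... | yes refl = f′ n (≤-trans (m≤n+m N′ N) l)
  ... | no t≢T = f t (≤∧≢⇒< (s≤s⁻¹ t<1+T) t≢T) n (≤-trans (m≤m+n N N′) l)

-- LYM counts in intervals and levels

∑-pos : ∀ {A : Set} (xs : List A) {f} → 0 < ∑ xs f → ∃ λ x → 0 < f x
∑-pos (x ∷ xs) {f} l with f x in eq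
... | zero = ∑-pos xs l
... | suc _ = x , subst (0 <_) (sym eq) (s≤s z≤n)

ind-pos : {P : Set} (d : Dec P) → 0 < ind d → P
ind-pos (yes p) _ = p

∑-1 : ∀ {A : Set} (xs : List A) → ∑ xs (λ _ → 1) ≡ length xs
∑-1 xs = trans (∑-const xs 1) (*-identityʳ _)

gap-full : ∀ {n} → gap n (∅ {n}) full
gap-full {n} = ⊆-min full , trans (cong (_+ n) (∣⊥∣≡0 n)) (sym (∣⊤∣≡n n))

module _ {n : ℕ} where

  cntI : Subset n → Subset n → List (Subset n) → ℕ
  cntI P Q G = ∑ G (λ A → ind (within? P Q A))

  -- The LYM inequality in [P , Q]: each member lies on at least d! / central d of the d! chains.
  cntI-≤ : ∀ d (P Q : Subset n) G → Unique G → gap d P Q → cntI P Q G * d ! ≤ central d * ∑ch d P Q (cnt G)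
  cntI-≤ d P Q G u g = begin
    cntI P Q G * d ! ≡⟨ *-comm (cntI P Q G) (d !) ⟩
    d ! * cntI P Q G ≡⟨ sym (∑-* G (d !) _) ⟩
    ∑ G (λ A → d ! * ind (within? P Q A)) ≤⟨ ∑-mono G (λ A _ → pt A) ⟩
    ∑ G (λ A → central d * (ind (within? P Q A) * wt P Q A)) ≡⟨ ∑-* G (central d) _ ⟩
    central d * ∑ G (λ A → ind (within? P Q A) * wt P Q A) ≡⟨ cong (central d *_) (sym (∑ch-cnt d P Q G u g)) ⟩
    central d * ∑ch d P Q (cnt G) ∎
    where
    open ≤-Reasoning
    pt : ∀ A → d ! * ind (within? P Q A) ≤ central d * (ind (within? P Q A) * wt P Q A)
    pt A with within? P Q A
    ... | no _ = ≤-trans (≤-reflexive (*-zeroʳ (d !))) z≤n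
    ... | yes (s , s′) = begin
      d ! * 1 ≡⟨ *-identityʳ (d !) ⟩
      d ! ≡⟨ cong _! (sym e) ⟩
      (a + b) ! ≡⟨ sym (bin-! a b) ⟩
      bin a b * (a ! * b !) ≤⟨ *-monoˡ-≤ (a ! * b !) (C≤central (a + b) a) ⟩
      central (a + b) * (a ! * b !) ≡⟨ cong₂ (λ x y → central x * y) e (sym (+-identityʳ (a ! * b !))) ⟩
      central d * (1 * (a ! * b !)) ∎
      where
      a b : ℕ
      a = ∣ A ∣ ∸ ∣ P ∣
      b = ∣ Q ∣ ∸ ∣ A ∣
      e : a + b ≡ d
      e = gap-+ (gap-∸ s) (gap-∸ s′) g

  cnt≤1 : ∀ k (G c : List (Subset n)) → (∀ {A} → A ∈ G → ∣ A ∣ ≡ k) → AllPairs _⊏_ c → cnt G c ≤ 1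
  cnt≤1 k G [] _ _ = z≤n
  cnt≤1 k G (B ∷ c) lev (B⊏ ∷ inc) with B ∈? G
  ... | no _ = cnt≤1 k G c lev inc
  ... | yes B∈G with cnt G c in eq
  ...   | zero = ≤-refl
  ...   | suc _ = let (D , D∈c , D∈G) = cnt-pos G c (subst (0 <_) (sym eq) (s≤s z≤n)) in
                  ⊥-elim (<-irrefl (trans (lev B∈G) (sym (lev D∈G))) (proj₂ (All.lookup B⊏ D∈c)))

  level-≤ : ∀ k (F : List (Subset n)) → Unique F → ∑ F (λ A → ind (∣ A ∣ ≟ k)) ≤ n C k
  level-≤ k F u with k ≤? n
  ... | no ¬l = ≤-trans (≤-reflexive (∑-zero F λ A _ → ind-no (∣ A ∣ ≟ k) (λ e → ¬l (subst (_≤ n) e (∣p∣≤n A))))) z≤n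
  ... | yes k≤n with m≤n⇒∃[o]m+o≡n k≤n
  ...   | l , refl = *-cancelʳ-≤ _ _ (k ! * l !) {{k !* l !≢0}} (begin
    ∑ F (λ A → ind (∣ A ∣ ≟ k)) * (k ! * l !) ≡⟨ cong (_* (k ! * l !)) (sym (length-filter-ind (λ A → ∣ A ∣ ≟ k) F)) ⟩
    length G * (k ! * l !) ≡⟨ sym (∑-const G _) ⟩
    ∑ G (λ _ → k ! * l !) ≡⟨ ∑-cong∈ G (λ A A∈ → sym (pt A∈)) ⟩
    ∑ G (λ A → ind (within? ∅ full A) * wt ∅ full A) ≡⟨ sym (∑ch-cnt (k + l) ∅ full G (Unique-filter⁺ (λ A → ∣ A ∣ ≟ k) u) gap-full) ⟩
    ∑ch (k + l) ∅ full (cnt G) ≤⟨ ∑ch-mono (k + l) ∅ full (λ c w → cnt≤1 k G c lev (Chain-increasing w)) ⟩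
    ∑ch (k + l) ∅ full (λ _ → 1) ≡⟨ ∑ch-const (k + l) ∅ full 1 gap-full ⟩
    (k + l) ! * 1 ≡⟨ *-identityʳ _ ⟩
    (k + l) ! ≡⟨ sym (bin-! k l) ⟩
    bin k l * (k ! * l !) ∎)
    where
    open ≤-Reasoning
    G : List (Subset (k + l))
    G = filter (λ A → ∣ A ∣ ≟ k) F
    lev : ∀ {A} → A ∈ G → ∣ A ∣ ≡ k
    lev A∈ = proj₂ (∈-filter⁻ (λ A → ∣ A ∣ ≟ k) {xs = F} A∈)
    pt : ∀ {A} → A ∈ G → ind (within? ∅ full A) * wt ∅ full A ≡ k ! * l !
    pt {A} A∈ = trans (cong₂ _*_ (ind-yes (within? ∅ full A) (⊆-min A , ⊆-max A))
      (cong₂ (λ x y → x ! * y !) (cong₂ _∸_ (lev A∈) (∣⊥∣≡0 (k + l)))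
                                 (trans (cong₂ _∸_ (∣⊤∣≡n (k + l)) (lev A∈)) (m+n∸m≡n k l))))
      (+-identityʳ _)

  small-≤ : ∀ K (F : List (Subset n)) → Unique F → ∑ F (λ A → ind (∣ A ∣ <? K)) ≤ sumTo K (n C_)
  small-≤ K F u = begin
    ∑ F (λ A → ind (∣ A ∣ <? K)) ≡⟨ trans (sym (length-filter-ind (λ A → ∣ A ∣ <? K) F)) (sym (∑-1 G)) ⟩
    ∑ G (λ _ → 1) ≡⟨ ∑-levels ∣_∣ (λ _ → 1) K G (λ A A∈ → proj₂ (∈-filter⁻ (λ A → ∣ A ∣ <? K) {xs = F} A∈)) ⟩
    sumTo K (λ k → ∑ G (λ A → ind (∣ A ∣ ≟ k)) * 1)
      ≤⟨ sumTo-mono K (λ k _ → ≤-trans (≤-reflexive (*-identityʳ _)) (level-≤ k G (Unique-filter⁺ (λ A → ∣ A ∣ <? K) u))) ⟩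
    sumTo K (n C_) ∎
    where
    open ≤-Reasoning
    G : List (Subset n)
    G = filter (λ A → ∣ A ∣ <? K) F

-- The cube when F has a small member

module _ {n h s : ℕ} {F : List (Subset n)} (¬Y : ¬ CopyY (2 + h) (suc s) F) (¬Y' : ¬ CopyY' (2 + h) (suc s) F)
         {E : Subset n} (E∈F : E ∈ F) (small : ∣ E ∣ < 6 * suc s)
         {G : List (Subset n)} (uG : Unique G) (G⊆F : ∀ {A} → A ∈ G → A ∈ F)
         (lo : ∀ {A} → A ∈ G → 2 * (6 * suc s) ≤ ∣ A ∣) (hi : ∀ {A} → A ∈ G → ∣ A ∣ + 2 * (6 * suc s) ≤ n) where

  private
    T : ℕ
    T = 6 * suc s
    2T≡ : 2 * T ≡ T + T
    2T≡ = cong (T +_) (+-identityʳ T)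

  -- Sizes in G stay 2T away from 0 and n: below, one T makes up for the size of P and the other is
  -- the distance that `∑ch-cnt-≤` asks for; above, the same room covers the element removed from
  -- `full`. The count is doubled because the bound above E involves a half.
  cube-≤ : ∀ t m P → gap t P E → gap m P full → 2 * cntI P full G ≤ cubeBound h t m
  cube-≤ zero m P g g′ with gap-0 g
  ... | refl = *-cancelʳ-≤ _ _ (m !) {{m !≢0}} (begin
    2 * cntI E full G * m ! ≡⟨ *-assoc 2 (cntI E full G) (m !) ⟩
    2 * (cntI E full G * m !) ≤⟨ *-monoʳ-≤ 2 (cntI-≤ m E full G uG g′) ⟩
    2 * (central m * ∑ch m E full (cnt G)) ≡⟨ ring (central m) _ ⟩
    central m * (2 * ∑ch m E full (cnt G)) ≤⟨ *-monoʳ-≤ (central m) (∑ch-cnt-bottom ¬Y uG G⊆F g′ E∈F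
        (λ A∈ → <-≤-trans small (≤-trans (m≤m+n T (1 * T)) (lo A∈)))
        (λ {A} A∈ → ≤-trans (+-monoʳ-≤ ∣ A ∣ (m≤m+n T (1 * T))) (≤-trans (hi A∈) (≤-reflexive (sym (∣⊤∣≡n n)))))) ⟩
    central m * ((3 + 2 * h) * m !) ≡⟨ ring′ (central m) (3 + 2 * h) (m !) ⟩
    (3 + 2 * h) * central m * m ! ∎)
    where
    open ≤-Reasoning
    ring : ∀ x y → 2 * (x * y) ≡ x * (2 * y)
    ring = solve-∀
    ring′ : ∀ x y z → x * (y * z) ≡ y * x * z
    ring′ = solve-∀
  cube-≤ (suc t) zero P g g′ = ⊥-elim (m+1+n≰m ∣ P ∣ (begin
    ∣ P ∣ + suc t ≡⟨ proj₂ g ⟩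
    ∣ E ∣ ≤⟨ ∣p∣≤n E ⟩
    n ≡⟨ sym (trans (proj₂ g′) (∣⊤∣≡n n)) ⟩
    ∣ P ∣ + 0 ≡⟨ +-identityʳ _ ⟩
    ∣ P ∣ ∎))
    where open ≤-Reasoning
  cube-≤ (suc t) (suc m) P g g′ with ∑-pos (allFin n) (subst (0 <_) (sym (length-free P E g)) (s≤s z≤n))
  ... | i , pos with isFree⁻ P E i (ind-pos (free? P E i) pos)
  ...   | i∉P , i∈E = begin
    2 * cntI P full G ≤⟨ *-monoʳ-≤ 2 (∑-mono G (λ A _ → pt A)) ⟩
    2 * ∑ G (λ A → ind (within? P Q A) + ind (within? (P ⊕ i) full A)) ≡⟨ cong (2 *_) (∑-+ G _ _) ⟩
    2 * (cntI P Q G + cntI (P ⊕ i) full G) ≡⟨ *-distribˡ-+ 2 (cntI P Q G) _ ⟩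
    2 * cntI P Q G + 2 * cntI (P ⊕ i) full G ≤⟨ +-mono-≤ (*-monoʳ-≤ 2 left) (cube-≤ t m (P ⊕ i) (gap-⊕ g i∉P i∈E) (gap-⊕ g′ i∉P i∈full)) ⟩
    2 * ((2 + h) * central m) + cubeBound h t m ∎
    where
    open ≤-Reasoning
    Q : Subset n
    Q = full ⊖ i
    i∈full : lookup full i ≡ true
    i∈full = ⊆-lookup (⊆-max E) i i∈E
    gQ : gap m P Q
    gQ = gap-⊖ g′ i∉P i∈full
    pt : ∀ A → ind (within? P full A) ≤ ind (within? P Q A) + ind (within? (P ⊕ i) full A)
    pt A with lookup A i in eq
    ... | true = ≤-trans (ind-mono (within? P full A) (within? (P ⊕ i) full A) (λ p → ⊕-⊆ (proj₁ p) eq , proj₂ p)) (m≤n+m _ _)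
    ... | false = ≤-trans (ind-mono (within? P full A) (within? P Q A) (λ p → proj₁ p , ⊆-⊖ (proj₂ p) eq)) (m≤m+n _ _)
    P<T : ∣ P ∣ ≤ T
    P<T = ≤-trans (p⊆q⇒∣p∣≤∣q∣ (proj₁ g)) (<⇒≤ small)
    left : cntI P Q G ≤ (2 + h) * central m
    left = *-cancelʳ-≤ _ _ (m !) {{m !≢0}} (begin
      cntI P Q G * m ! ≤⟨ cntI-≤ m P Q G uG gQ ⟩
      central m * ∑ch m P Q (cnt G) ≤⟨ *-monoʳ-≤ (central m) (∑ch-cnt-≤ ¬Y ¬Y' uG G⊆F gQ
        (λ A∈ → ≤-trans (+-monoˡ-≤ T P<T) (≤-trans (≤-reflexive (sym 2T≡)) (lo A∈)))
        (λ {A} A∈ → s≤s⁻¹ (begin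
          suc (∣ A ∣ + T) ≡⟨ sym (+-suc ∣ A ∣ T) ⟩
          ∣ A ∣ + suc T ≤⟨ +-monoʳ-≤ ∣ A ∣ (+-monoˡ-≤ T (s≤s z≤n)) ⟩
          ∣ A ∣ + (T + T) ≡⟨ cong (∣ A ∣ +_) (sym 2T≡) ⟩
          ∣ A ∣ + 2 * T ≤⟨ hi A∈ ⟩
          n ≡⟨ sym (∣⊤∣≡n n) ⟩
          ∣ full {n} ∣ ≡⟨ sym (∣⊖∣ full i i∈full) ⟩
          suc ∣ Q ∣ ∎))) ⟩
      central m * ((2 + h) * m !) ≡⟨ ring (central m) (2 + h) (m !) ⟩
      (2 + h) * central m * m ! ∎)
      where
      ring : ∀ x y z → x * (y * z) ≡ y * x * z
      ring = solve-∀

-- From the Lubell function to the size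

sumBinom-sumTo : ∀ n b k → sumBinom n b k ≡ sumTo k (λ i → n C (suc b + i))
sumBinom-sumTo n b zero = refl
sumBinom-sumTo n b (suc k) = cong₂ _+_ (sumBinom-sumTo n b k) (cong (n C_) (+-suc b k))

middle-position : ∀ n H → H ≤ n → let b = (n ∸ H) / 2 in (b + b + H ≤ n) × (n ≤ suc (b + b + H))
middle-position n H H≤n = lower , upper
  where
  open ≤-Reasoning
  b r : ℕ
  b = (n ∸ H) / 2
  r = (n ∸ H) % 2
  e : n ≡ r + (b + b + H)
  e = begin-equality
    n ≡⟨ sym (m∸n+n≡m H≤n) ⟩
    n ∸ H + H ≡⟨ cong (_+ H) (m≡m%n+[m/n]*n (n ∸ H) 2) ⟩
    r + b * 2 + H ≡⟨ ring r b H ⟩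
    r + (b + b + H) ∎
    where
    ring : ∀ r b H → r + b * 2 + H ≡ r + (b + b + H)
    ring = solve-∀
  lower : b + b + H ≤ n
  lower = ≤-trans (m≤n+m _ r) (≤-reflexive (sym e))
  upper : n ≤ suc (b + b + H)
  upper = ≤-trans (≤-reflexive e) (+-monoˡ-≤ (b + b + H) (s≤s⁻¹ (m%n<n (n ∸ H) 2)))

-- (C − f)(C − t) ≥ 0
product-≥0 : ∀ C f t → f ≤ C → t ≤ C → f * C + t * C ≤ t * f + C * C
product-≥0 C f t f≤C t≤C with m≤n⇒∃[o]m+o≡n t≤C
... | u , refl = begin
  f * (t + u) + t * (t + u) ≡⟨ ring f t u ⟩
  u * f + (t * f + t * (t + u)) ≤⟨ +-monoˡ-≤ (t * f + t * (t + u)) (*-monoʳ-≤ u f≤C) ⟩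
  u * (t + u) + (t * f + t * (t + u)) ≡⟨ ring′ f t u ⟩
  t * f + (t + u) * (t + u) ∎
  where
  open ≤-Reasoning
  ring : ∀ f t u → f * (t + u) + t * (t + u) ≡ u * f + (t * f + t * (t + u))
  ring = solve-∀
  ring′ : ∀ f t u → u * (t + u) + (t * f + t * (t + u)) ≡ t * f + (t + u) * (t + u)
  ring′ = solve-∀

-- The threshold is t = C(n , b + H), the smallest of the H middle binomial coefficients:
-- the middle levels have C ≥ t, all others C ≤ t.
lubell⇒Sigma : ∀ {n} H (F : List (Subset n)) → Unique F → H ≤ n →
  ∑ F (λ A → ∣ A ∣ ! * (n ∸ ∣ A ∣) !) ≤ H * n ! → length F ≤ Sigma n H
lubell⇒Sigma {n} H F u H≤n lub = *-cancelʳ-≤ _ _ (n !) {{n !≢0}} (+-cancelʳ-≤ (H * (t * n !)) _ _ (begin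
  -- H copies of t n! are added, one for each middle level, where (C - f)(C - t) ≥ 0 gives f + t ≤ t
  -- f/C + C. They cancel against t times the Lubell bound at the end.
  length F * n ! + H * (t * n !)
    ≡⟨ cong₂ _+_ len (sym (sumTo-const H (t * n !))) ⟩
  sumTo (suc b + (H + r)) (λ k → f k * n !) + sumTo H (λ _ → t * n !)
    ≡⟨ cong (_+ sumTo H (λ _ → t * n !)) (split3 (λ k → f k * n !)) ⟩
  (x₁ + (x₂ + x₃)) + sumTo H (λ _ → t * n !) ≡⟨ ring x₁ x₂ x₃ _ ⟩
  x₁ + ((x₂ + sumTo H (λ _ → t * n !)) + x₃)
    ≤⟨ +-mono-≤ (sumTo-mono (suc b) (λ k k<1+b → outside k (below (s≤s⁻¹ k<1+b)) (k≤n-low k k<1+b)))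
         (+-mono-≤ (subst₂ _≤_ (sumTo-+ H _ _) (sumTo-+ H _ _)
             (sumTo-mono H (λ i i<H → inside (suc b + i) (within-C i i<H) (k≤n-mid i i<H))))
           (sumTo-mono r (λ i i<r → outside (suc b + (H + i)) (above i i<r) (k≤n-high i i<r)))) ⟩
  y₁ + ((y₂ + sumTo H (λ i → (n C (suc b + i)) * n !)) + y₃) ≡⟨ sym (ring y₁ y₂ y₃ _) ⟩
  (y₁ + (y₂ + y₃)) + sumTo H (λ i → (n C (suc b + i)) * n !)
    ≡⟨ cong₂ _+_ (sym (split3 (λ k → t * (f k * w k)))) middle ⟩
  sumTo (suc b + (H + r)) (λ k → t * (f k * w k)) + Sigma n H * n !
    ≡⟨ cong (_+ Sigma n H * n !) (trans (sumTo-* (suc b + (H + r)) t (λ k → f k * w k)) (cong (t *_) (sym lubEq))) ⟩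
  t * ∑ F (λ A → w ∣ A ∣) + Sigma n H * n ! ≤⟨ +-monoˡ-≤ (Sigma n H * n !) (*-monoʳ-≤ t lub) ⟩
  t * (H * n !) + Sigma n H * n ! ≡⟨ ring′ t H (n !) (Sigma n H * n !) ⟩
  Sigma n H * n ! + H * (t * n !) ∎))
  where
  open ≤-Reasoning
  b r t : ℕ
  b = (n ∸ H) / 2
  r = n ∸ (b + H)
  t = n C (b + H)
  pos : (b + b + H ≤ n) × (n ≤ suc (b + b + H))
  pos = middle-position n H H≤n
  b+H≤n : b + H ≤ n
  b+H≤n = ≤-trans (+-monoˡ-≤ H (m≤m+n b b)) (proj₁ pos)
  n≡ : suc n ≡ suc b + (H + r)
  n≡ = cong suc (sym (trans (sym (+-assoc b H r)) (m+[n∸m]≡n b+H≤n)))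
  f w : ℕ → ℕ
  f k = ∑ F (λ A → ind (∣ A ∣ ≟ k))
  w k = k ! * (n ∸ k) !
  x₁ x₂ x₃ y₁ y₂ y₃ : ℕ
  x₁ = sumTo (suc b) (λ k → f k * n !)
  x₂ = sumTo H (λ i → f (suc b + i) * n !)
  x₃ = sumTo r (λ i → f (suc b + (H + i)) * n !)
  y₁ = sumTo (suc b) (λ k → t * (f k * w k))
  y₂ = sumTo H (λ i → t * (f (suc b + i) * w (suc b + i)))
  y₃ = sumTo r (λ i → t * (f (suc b + (H + i)) * w (suc b + (H + i))))
  split3 : ∀ (g : ℕ → ℕ) → sumTo (suc b + (H + r)) g ≡
    sumTo (suc b) g + (sumTo H (λ i → g (suc b + i)) + sumTo r (λ i → g (suc b + (H + i))))
  split3 g = trans (sumTo-split (suc b) (H + r) g) (cong (sumTo (suc b) g +_) (sumTo-split H r (λ i → g (suc b + i))))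
  middle : sumTo H (λ i → (n C (suc b + i)) * n !) ≡ Sigma n H * n !
  middle = trans (sumTo-cong H (λ i _ → *-comm (n C (suc b + i)) (n !)))
    (trans (sumTo-* H (n !) _) (trans (*-comm (n !) _) (cong (_* n !) (sym (sumBinom-sumTo n b H)))))
  levels : ∀ (g : ℕ → ℕ) → ∑ F (λ A → g ∣ A ∣) ≡ sumTo (suc b + (H + r)) (λ k → f k * g k)
  levels g = trans (∑-levels ∣_∣ g (suc n) F (λ A _ → s≤s (∣p∣≤n A))) (cong (λ N → sumTo N (λ k → f k * g k)) n≡)
  len : length F * n ! ≡ sumTo (suc b + (H + r)) (λ k → f k * n !)
  len = trans (sym (∑-const F (n !))) (levels (λ _ → n !))
  lubEq : ∑ F (λ A → w ∣ A ∣) ≡ sumTo (suc b + (H + r)) (λ k → f k * w k)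
  lubEq = levels w
  ring : ∀ a b c d → (a + (b + c)) + d ≡ a + ((b + d) + c)
  ring = solve-∀
  ring′ : ∀ t H x y → t * (H * x) + y ≡ y + H * (t * x)
  ring′ = solve-∀
  n!≡ : ∀ k → k ≤ n → n ! ≡ (n C k) * w k
  n!≡ k k≤n with m≤n⇒∃[o]m+o≡n k≤n
  ... | l , refl = sym (trans (cong (λ x → bin k l * (k ! * x !)) (m+n∸m≡n k l)) (bin-! k l))
  outside : ∀ k → n C k ≤ t → k ≤ n → f k * n ! ≤ t * (f k * w k)
  outside k le k≤n = begin
    f k * n ! ≡⟨ cong (f k *_) (n!≡ k k≤n) ⟩
    f k * ((n C k) * w k) ≡⟨ swap (f k) (n C k) (w k) ⟩
    (n C k) * (f k * w k) ≤⟨ *-monoˡ-≤ (f k * w k) le ⟩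
    t * (f k * w k) ∎
    where
    swap : ∀ x y z → x * (y * z) ≡ y * (x * z)
    swap = solve-∀
  inside : ∀ k → t ≤ n C k → k ≤ n → f k * n ! + t * n ! ≤ t * (f k * w k) + (n C k) * n !
  inside k le k≤n = begin
    f k * n ! + t * n ! ≡⟨ cong (λ x → f k * x + t * x) (n!≡ k k≤n) ⟩
    f k * (c * w k) + t * (c * w k) ≡⟨ ring₁ (f k) t c (w k) ⟩
    (f k * c + t * c) * w k ≤⟨ *-monoˡ-≤ (w k) (product-≥0 c (f k) t (level-≤ k F u) le) ⟩
    (t * f k + c * c) * w k ≡⟨ ring₂ (f k) t c (w k) ⟩
    t * (f k * w k) + c * (c * w k) ≡⟨ cong (λ x → t * (f k * w k) + c * x) (sym (n!≡ k k≤n)) ⟩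
    t * (f k * w k) + c * n ! ∎
    where
    c : ℕ
    c = n C k
    ring₁ : ∀ f t c w → f * (c * w) + t * (c * w) ≡ (f * c + t * c) * w
    ring₁ = solve-∀
    ring₂ : ∀ f t c w → (t * f + c * c) * w ≡ t * (f * w) + c * (c * w)
    ring₂ = solve-∀
  below : ∀ {k} → k ≤ b → n C k ≤ t
  below {k} k≤b = C-unimodal n k (b + H) (≤-trans k≤b (m≤m+n b H))
    (≤-trans (+-monoˡ-≤ (b + H) k≤b) (≤-trans (≤-reflexive (sym (+-assoc b b H))) (proj₁ pos)))
  n∸[b+H]≤1+b : n ∸ (b + H) ≤ suc b
  n∸[b+H]≤1+b = m≤n+o⇒m∸n≤o n (b + H) (≤-trans (proj₂ pos) (≤-reflexive (ring₁ b H)))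
    where
    ring₁ : ∀ b H → suc (b + b + H) ≡ b + H + suc b
    ring₁ = solve-∀
  k≤n-low : ∀ k → k < suc b → k ≤ n
  k≤n-low k (s≤s k≤b) = ≤-trans k≤b (≤-trans (m≤m+n b H) b+H≤n)
  mid≤ : ∀ i → i < H → suc b + i ≤ b + H
  mid≤ i i<H = ≤-trans (≤-reflexive (sym (+-suc b i))) (+-monoʳ-≤ b i<H)
  k≤n-mid : ∀ i → i < H → suc b + i ≤ n
  k≤n-mid i i<H = ≤-trans (mid≤ i i<H) b+H≤n
  -- The level b + H is reflected to n - (b + H), which is b or b + 1 and so no higher than any
  -- middle level.
  within-C : ∀ i → i < H → t ≤ n C (suc b + i)
  within-C i i<H = subst (_≤ n C (suc b + i)) (sym (nCk≡nC[n∸k] b+H≤n))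
    (C-unimodal n (n ∸ (b + H)) (suc b + i) (≤-trans n∸[b+H]≤1+b (m≤m+n (suc b) i))
      (≤-trans (+-monoʳ-≤ (n ∸ (b + H)) (mid≤ i i<H)) (≤-reflexive (m∸n+n≡m b+H≤n))))
  k≤n-high : ∀ i → i < r → suc b + (H + i) ≤ n
  k≤n-high i i<r = s≤s⁻¹ (≤-trans (≤-reflexive (sym (trans (+-suc (suc b) (H + i)) refl)))
    (≤-trans (+-monoʳ-≤ (suc b) (≤-trans (≤-reflexive (sym (+-suc H i))) (+-monoʳ-≤ H i<r))) (≤-reflexive (sym n≡))))
  above : ∀ i → i < r → n C (suc b + (H + i)) ≤ t
  above i i<r = subst (_≤ t) (sym (nCk≡nC[n∸k] (k≤n-high i i<r)))
    (below (m≤n+o⇒m∸n≤o n (suc b + (H + i)) (≤-trans (proj₂ pos)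
      (≤-trans (m≤m+n _ i) (≤-reflexive (ring₁ b H i))))))
    where
    ring₁ : ∀ b H i → suc (b + b + H) + i ≡ suc b + (H + i) + b
    ring₁ = solve-∀

-- Estimates for large n and the upper bound

-- For a middle level k, the numbers k and n - k differ by at most H + 1, so each of the H terms is
-- close to the central coefficient.
Sigma-flat : ∀ M H n → H ≤ n → 2 * (M * suc H * suc H) ≤ n → M * (H * central n) ≤ M * Sigma n H + H * central n
Sigma-flat M H n H≤n big = begin
  M * (H * central n) ≡⟨ trans (swap M H (central n)) (sym (sumTo-const H (M * central n))) ⟩
  sumTo H (λ _ → M * central n) ≤⟨ sumTo-mono H pt ⟩
  sumTo H (λ i → M * (n C (suc b + i)) + central n)
    ≡⟨ trans (sumTo-+ H _ _) (cong₂ _+_ (trans (sumTo-* H M _) (cong (M *_) (sym (sumBinom-sumTo n b H)))) (sumTo-const H (central n))) ⟩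
  M * Sigma n H + H * central n ∎
  where
  open ≤-Reasoning
  swap : ∀ x y z → x * (y * z) ≡ y * (x * z)
  swap = solve-∀
  b : ℕ
  b = (n ∸ H) / 2
  pos : (b + b + H ≤ n) × (n ≤ suc (b + b + H))
  pos = middle-position n H H≤n
  pt : ∀ i → i < H → M * central n ≤ M * (n C (suc b + i)) + central n
  pt i i<H = subst (λ x → M * central x ≤ M * (x C k) + central x) k+l≡n
    (bin-flat-sym M H k l
      (+-cancelˡ-≤ k _ _ (begin
        k + k ≤⟨ +-mono-≤ k≤ k≤ ⟩
        (b + H) + (b + H) ≡⟨ ring₁ b H ⟩
        (b + b + H) + H ≤⟨ +-mono-≤ (proj₁ pos) (n≤1+n H) ⟩
        n + suc H ≡⟨ trans (cong (_+ suc H) (sym k+l≡n)) (+-assoc k l (suc H)) ⟩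
        k + (l + suc H) ∎))
      (+-cancelˡ-≤ k _ _ (begin
        k + l ≡⟨ k+l≡n ⟩
        n ≤⟨ proj₂ pos ⟩
        suc (b + b + H) ≤⟨ s≤s (+-mono-≤ (+-mono-≤ b≤k b≤k) ≤-refl) ⟩
        suc (k + k + H) ≡⟨ ring₂ k H ⟩
        k + (k + suc H) ∎))
      (≤-trans big (≤-reflexive (sym k+l≡n))))
    where
    k l : ℕ
    k = suc b + i
    l = n ∸ k
    k≤ : k ≤ b + H
    k≤ = ≤-trans (≤-reflexive (sym (+-suc b i))) (+-monoʳ-≤ b i<H)
    b≤k : b ≤ k
    b≤k = ≤-trans (n≤1+n b) (m≤m+n (suc b) i)
    k+l≡n : k + l ≡ n
    k+l≡n = m+[n∸m]≡n (≤-trans k≤ (≤-trans (+-monoˡ-≤ H (m≤m+n b b)) (proj₁ pos)))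
    ring₁ : ∀ b H → (b + H) + (b + H) ≡ (b + b + H) + H
    ring₁ = solve-∀
    ring₂ : ∀ k H → suc (k + k + H) ≡ k + (k + suc H)
    ring₂ = solve-∀

low-levels-≤ : ∀ K U n → U * K * U + U ≤ n → K * sumTo U (n C_) ≤ central n
low-levels-≤ K zero n _ = ≤-trans (≤-reflexive (*-zeroʳ K)) z≤n
low-levels-≤ K U@(suc _) n big = *-cancelˡ-≤ U (begin
  U * (K * sumTo U (n C_)) ≡⟨ sym (*-assoc U K _) ⟩
  U * K * sumTo U (n C_) ≡⟨ sym (sumTo-* U (U * K) _) ⟩
  sumTo U (λ k → U * K * (n C k)) ≤⟨ sumTo-mono U (λ k k<U → C-growth (U * K) n k
      (≤-trans (+-mono-≤ (*-monoʳ-≤ (U * K) k<U) (<⇒≤ k<U)) big)) ⟩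
  sumTo U (λ _ → central n) ≡⟨ sumTo-const U _ ⟩
  U * central n ∎)
  where open ≤-Reasoning

few-extreme-bound : ∀ {n h s} {F : List (Subset n)} → Unique F →
  ¬ CopyY (2 + h) (suc s) F → ¬ CopyY' (2 + h) (suc s) F → 2 + h ≤ n →
  (∀ {A} → A ∈ F → 6 * suc s ≤ ∣ A ∣) → (∀ {A} → A ∈ F → ∣ A ∣ + 6 * suc s ≤ n) →
  length F ≤ Sigma n (2 + h)
few-extreme-bound {n} {h} {s} {F} u ¬Y ¬Y' H≤n lo hi = lubell⇒Sigma (2 + h) F u H≤n (begin
  ∑ F (λ A → ∣ A ∣ ! * (n ∸ ∣ A ∣) !) ≡⟨ ∑-cong F (λ A → sym (trans
      (cong₂ _*_ (ind-yes (within? ∅ full A) (⊆-min A , ⊆-max A))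
        (cong₂ (λ x y → (∣ A ∣ ∸ x) ! * (y ∸ ∣ A ∣) !) (∣⊥∣≡0 n) (∣⊤∣≡n n))) (+-identityʳ _))) ⟩
  ∑ F (λ A → ind (within? ∅ full A) * wt ∅ full A) ≡⟨ sym (∑ch-cnt n ∅ full F u gap-full) ⟩
  ∑ch n ∅ full (cnt F) ≤⟨ ∑ch-cnt-≤ ¬Y ¬Y' u id gap-full
      (λ A∈ → ≤-trans (≤-reflexive (cong (_+ 6 * suc s) (∣⊥∣≡0 n))) (lo A∈))
      (λ A∈ → ≤-trans (hi A∈) (≤-reflexive (sym (∣⊤∣≡n n)))) ⟩
  (2 + h) * n ! ∎)
  where open ≤-Reasoning

-- The budget for a small member of size t, in units of `central n` and with sizes multiplied by 4 ·
-- 4^t. The first inequality, doubled, gains 2; the second loses 1 to the unevenness of the middle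
-- layers; the third loses 1 to the sets of extreme size, its 8 being 4 for either end.
Large : (h s t n : ℕ) → Set
Large h s t n =
  (4 ^ t * cubeBound h t n + central n ≤ 2 * (2 + h) * 4 ^ t * central n) ×
  (4 * 4 ^ t * ((2 + h) * central n) ≤ 4 * 4 ^ t * Sigma n (2 + h) + central n) ×
  (8 * 4 ^ t * sumTo (2 * (6 * suc s)) (n C_) ≤ central n)

eventually-Large : ∀ h s t → ∃ λ N → ∀ n → N ≤ n → Large h s t n
eventually-Large h s t with cubeBound-gap h t
... | N₁ , gap₁ = N₁ + (N₂ + N₃) , λ n l →
    gap₁ n (≤-trans (m≤m+n N₁ _) l) ,
    flat n (≤-trans (≤-trans (m≤m+n N₂ N₃) (m≤n+m _ N₁)) l) ,
    low-levels-≤ (8 * K) U n (≤-trans (≤-trans (m≤n+m N₃ N₂) (m≤n+m _ N₁)) l)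
  where
  open ≤-Reasoning
  H K U M N₂ N₃ : ℕ
  H = 2 + h
  K = 4 ^ t
  U = 2 * (6 * suc s)
  -- The factor H cancels the H in the error term of `Sigma-flat` and leaves a single central
  -- coefficient.
  M = 4 * K * H
  N₂ = H + 2 * (M * suc H * suc H)
  N₃ = U * (8 * K) * U + U
  flat : ∀ n → N₂ ≤ n → 4 * K * (H * central n) ≤ 4 * K * Sigma n H + central n
  flat n l = *-cancelˡ-≤ H (begin
    H * (4 * K * (H * central n)) ≡⟨ ring₁ H (4 * K) (H * central n) ⟩
    M * (H * central n) ≤⟨ Sigma-flat M H n (≤-trans (m≤m+n H _) l) (≤-trans (m≤n+m _ H) l) ⟩
    M * Sigma n H + H * central n ≡⟨ ring₂ H (4 * K) (Sigma n H) (central n) ⟩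
    H * (4 * K * Sigma n H + central n) ∎)
    where
    ring₁ : ∀ H k x → H * (k * x) ≡ k * H * x
    ring₁ = solve-∀
    ring₂ : ∀ H k x y → k * H * x + H * y ≡ H * (k * x + y)
    ring₂ = solve-∀

small-set-bound : ∀ {n h s} {F : List (Subset n)} → Unique F →
  ¬ CopyY (2 + h) (suc s) F → ¬ CopyY' (2 + h) (suc s) F →
  ∀ {E} → E ∈ F → ∣ E ∣ < 6 * suc s → Large h s ∣ E ∣ n → length F ≤ Sigma n (2 + h)
small-set-bound {n} {h} {s} {F} u ¬Y ¬Y' {E} E∈F small (cube , flat , low) =
  *-cancelˡ-≤ (4 * K) {{m*n≢0 4 K {{_}} {{m^n≢0 4 ∣ E ∣}}}} (+-cancelʳ-≤ (c + c) _ _ (begin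
    4 * K * length F + (c + c) ≤⟨ +-monoˡ-≤ (c + c) (*-monoʳ-≤ (4 * K) size) ⟩
    4 * K * (length G + (S + S)) + (c + c) ≡⟨ ring₁ K (length G) S c ⟩
    (2 * (K * (2 * length G) + c)) + 8 * K * S
      ≤⟨ +-mono-≤ (*-monoʳ-≤ 2 (≤-trans (+-monoˡ-≤ c (*-monoʳ-≤ K 2∣G∣≤)) cube)) low ⟩
    2 * (2 * H * K * c) + c ≡⟨ cong (_+ c) (ring₂ H K c) ⟩
    4 * K * (H * c) + c ≤⟨ +-monoˡ-≤ c flat ⟩
    4 * K * Sigma n H + c + c ≡⟨ +-assoc _ c c ⟩
    4 * K * Sigma n H + (c + c) ∎))
  where
  open ≤-Reasoning
  H K U c S : ℕ
  H = 2 + h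
  K = 4 ^ ∣ E ∣
  U = 2 * (6 * suc s)
  c = central n
  S = sumTo U (n C_)
  ring₁ : ∀ K g S c → 4 * K * (g + (S + S)) + (c + c) ≡ (2 * (K * (2 * g) + c)) + 8 * K * S
  ring₁ = solve-∀
  ring₂ : ∀ H K c → 2 * (2 * H * K * c) ≡ 4 * K * (H * c)
  ring₂ = solve-∀
  mid? : ∀ A → Dec (U ≤ ∣ A ∣ × ∣ A ∣ + U ≤ n)
  mid? A = (U ≤? ∣ A ∣) ×-dec (∣ A ∣ + U ≤? n)
  G : List (Subset n)
  G = filter mid? F
  G⁻ : ∀ {A} → A ∈ G → A ∈ F × U ≤ ∣ A ∣ × ∣ A ∣ + U ≤ n
  G⁻ = ∈-filter⁻ mid?
  2∣G∣≤ : 2 * length G ≤ cubeBound h ∣ E ∣ n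
  2∣G∣≤ = begin
    2 * length G ≡⟨ cong (2 *_) (trans (sym (∑-1 G)) (∑-cong G (λ A → sym (ind-yes (within? ∅ full A) (⊆-min A , ⊆-max A))))) ⟩
    2 * cntI ∅ full G ≤⟨ cube-≤ ¬Y ¬Y' E∈F small (Unique-filter⁺ mid? u) (λ A∈ → proj₁ (G⁻ A∈))
        (λ A∈ → proj₁ (proj₂ (G⁻ A∈))) (λ A∈ → proj₂ (proj₂ (G⁻ A∈))) ∣ E ∣ n ∅
        (⊆-min E , cong (_+ ∣ E ∣) (∣⊥∣≡0 n)) gap-full ⟩
    cubeBound h ∣ E ∣ n ∎
  cover : ∀ A → 1 ≤ ind (mid? A) + (ind (∣ A ∣ <? U) + ind (∣ ∁ A ∣ <? U))
  cover A = aux (U ≤? ∣ A ∣) (∣ A ∣ + U ≤? n)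
    where
    aux : Dec (U ≤ ∣ A ∣) → Dec (∣ A ∣ + U ≤ n) → 1 ≤ ind (mid? A) + (ind (∣ A ∣ <? U) + ind (∣ ∁ A ∣ <? U))
    aux (yes p) (yes q) = ≤-trans (≤-reflexive (sym (ind-yes (mid? A) (p , q)))) (m≤m+n _ _)
    aux (no ¬p) _ = ≤-trans (≤-trans (≤-reflexive (sym (ind-yes (∣ A ∣ <? U) (≰⇒> ¬p)))) (m≤m+n _ _)) (m≤n+m _ (ind (mid? A)))
    aux (yes _) (no ¬q) = ≤-trans (≤-trans (≤-reflexive (sym (ind-yes (∣ ∁ A ∣ <? U)
      (+-cancelˡ-< ∣ A ∣ _ _ (≤-<-trans (≤-reflexive (∣∁∣ A)) (≰⇒> ¬q)))))) (m≤n+m _ (ind (∣ A ∣ <? U)))) (m≤n+m _ (ind (mid? A)))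
  size : length F ≤ length G + (S + S)
  size = begin
    length F ≡⟨ sym (∑-1 F) ⟩
    ∑ F (λ _ → 1) ≤⟨ ∑-mono F (λ A _ → cover A) ⟩
    ∑ F (λ A → ind (mid? A) + (ind (∣ A ∣ <? U) + ind (∣ ∁ A ∣ <? U)))
      ≡⟨ trans (∑-+ F _ _) (cong₂ _+_ (sym (length-filter-ind mid? F)) (trans (∑-+ F _ _)
           (cong (∑ F (λ A → ind (∣ A ∣ <? U)) +_) (sym (∑-map ∁ F (λ A → ind (∣ A ∣ <? U))))))) ⟩
    length G + (∑ F (λ A → ind (∣ A ∣ <? U)) + ∑ (map ∁ F) (λ A → ind (∣ A ∣ <? U)))
      ≤⟨ +-monoʳ-≤ (length G) (+-mono-≤ (small-≤ U F u) (small-≤ U (map ∁ F) (Unique-map⁺ ∁-inj u))) ⟩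
    length G + (S + S) ∎

upper-bound : ∀ {n h s} (F : Family n) → Free (2 + h) (suc s) F → 2 + h ≤ n →
  (∀ t → t < 6 * suc s → Large h s t n) → length (sets F) ≤ Sigma n (2 + h)
upper-bound {n} {h} {s} (family F u) (¬Y , ¬Y') H≤n large
  with any? (λ A → ∣ A ∣ <? 6 * suc s) F | any? (λ A → n <? ∣ A ∣ + 6 * suc s) F
... | yes small | _ = let (E , E∈F , l) = find small in
  small-set-bound u ¬Y ¬Y' E∈F l (large ∣ E ∣ l)
... | no _ | yes big = let (E , E∈F , l) = find big
                           l′ = +-cancelˡ-< ∣ E ∣ _ _ (≤-<-trans (≤-reflexive (∣∁∣ E)) l) in
  subst (_≤ Sigma n (2 + h)) (length-map ∁ F)
    (small-set-bound (Unique-map⁺ ∁-inj u) (¬Y' ∘ CopyY-∁) (¬Y ∘ CopyY'-∁) (∈-map⁺ ∁ E∈F) l′ (large ∣ ∁ E ∣ l′))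
... | no ¬small | no ¬big = few-extreme-bound u ¬Y ¬Y' H≤n
  (λ A∈ → ≮⇒≥ (λ l → ¬small (lose A∈ l))) (λ A∈ → ≮⇒≥ (λ l → ¬big (lose A∈ l)))

-- The middle layers

layer : ∀ n → ℕ → List (Subset n)
layer zero zero = [] ∷ []
layer zero (suc k) = []
layer (suc n) zero = map (false ∷_) (layer n zero)
layer (suc n) (suc k) = map (true ∷_) (layer n k) ++ map (false ∷_) (layer n (suc k))

nC0≡1 : ∀ n → n C 0 ≡ 1
nC0≡1 n = trans (nCk≡nC[n∸k] {n = n} z≤n) (nCn≡1 n)

length-layer : ∀ n k → length (layer n k) ≡ n C k
length-layer zero zero = refl
length-layer zero (suc k) = sym (k>n⇒nCk≡0 {0} {suc k} (s≤s z≤n))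
length-layer (suc n) zero = trans (length-map (false ∷_) (layer n 0)) (trans (length-layer n 0) (trans (nC0≡1 n) (sym (nC0≡1 (suc n)))))
length-layer (suc n) (suc k) = begin
  length (map (true ∷_) (layer n k) ++ map (false ∷_) (layer n (suc k)))
    ≡⟨ length-++ (map (true ∷_) (layer n k)) ⟩
  length (map (true ∷_) (layer n k)) + length (map (false ∷_) (layer n (suc k)))
    ≡⟨ cong₂ _+_ (trans (length-map _ (layer n k)) (length-layer n k)) (trans (length-map _ (layer n (suc k))) (length-layer n (suc k))) ⟩
  n C k + n C suc k ≡⟨ nCk+nC[k+1]≡[n+1]C[k+1] n k ⟩
  suc n C suc k ∎
  where open ≡-Reasoning

layer-size : ∀ n k {A} → A ∈ layer n k → ∣ A ∣ ≡ k
layer-size zero zero (here refl) = refl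
layer-size (suc n) zero A∈ with ∈-map⁻ (false ∷_) A∈
... | B , B∈ , refl = layer-size n zero B∈
layer-size (suc n) (suc k) A∈ with ∈-++⁻ (map (true ∷_) (layer n k)) A∈
... | inj₁ p with ∈-map⁻ (true ∷_) p
...   | B , B∈ , refl = cong suc (layer-size n k B∈)
layer-size (suc n) (suc k) A∈ | inj₂ p with ∈-map⁻ (false ∷_) p
...   | B , B∈ , refl = layer-size n (suc k) B∈

layer-unique : ∀ n k → Unique (layer n k)
layer-unique zero zero = [] ∷ []
layer-unique zero (suc k) = []
layer-unique (suc n) zero = Unique-map⁺ ∷-injectiveʳ (layer-unique n zero)
layer-unique (suc n) (suc k) = Unique-++⁺
  (Unique-map⁺ ∷-injectiveʳ (layer-unique n k)) (Unique-map⁺ ∷-injectiveʳ (layer-unique n (suc k))) disjoint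
  where
  disjoint : ∀ {A} → ¬ (A ∈ map (true ∷_) (layer n k) × A ∈ map (false ∷_) (layer n (suc k)))
  disjoint (p , q) with ∈-map⁻ (true ∷_) p | ∈-map⁻ (false ∷_) q
  ... | _ , _ , refl | _ , _ , ()

layers : ∀ n → ℕ → ℕ → List (Subset n)
layers n b zero = []
layers n b (suc k) = layers n b k ++ layer n (b + suc k)

length-layers : ∀ n b k → length (layers n b k) ≡ sumBinom n b k
length-layers n b zero = refl
length-layers n b (suc k) = trans (length-++ (layers n b k)) (cong₂ _+_ (length-layers n b k) (length-layer n (b + suc k)))

layers-size : ∀ n b k {A} → A ∈ layers n b k → suc b ≤ ∣ A ∣ × ∣ A ∣ ≤ b + k
layers-size n b (suc k) A∈ with ∈-++⁻ (layers n b k) A∈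
... | inj₁ p = let (l , m) = layers-size n b k p in l , ≤-trans m (+-monoʳ-≤ b (n≤1+n k))
... | inj₂ p rewrite layer-size n (b + suc k) p = ≤-trans (s≤s (m≤m+n b k)) (≤-reflexive (sym (+-suc b k))) , ≤-refl

layers-unique : ∀ n b k → Unique (layers n b k)
layers-unique n b zero = []
layers-unique n b (suc k) = Unique-++⁺ (layers-unique n b k) (layer-unique n (b + suc k))
  λ { (p , q) → <-irrefl (layer-size n (b + suc k) q) (≤-<-trans (proj₂ (layers-size n b k p)) (+-monoʳ-< b ≤-refl)) }

-- The x's and one y of a copy form a chain of h + 2 members, which needs h + 2 sizes where only h +
-- 1 are available.
window⇒¬CopyY : ∀ {n h s} (F : List (Subset n)) c → (∀ {A} → A ∈ F → c ≤ ∣ A ∣ × ∣ A ∣ < c + suc h) → ¬ CopyY (suc h) (suc s) F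
window⇒¬CopyY {n} {h} F c win C = <-irrefl refl (begin-strict
  c + h ≤⟨ grow h ≤-refl ⟩
  ∣ x h ≤-refl ∣ <⟨ proj₂ (⊆∧≢⇒⊏ (X⊆Y _ zero) (XY-dist _ zero)) ⟩
  ∣ Y zero ∣ ≤⟨ s≤s⁻¹ (≤-trans (proj₂ (win (Y∈ zero))) (≤-reflexive (+-suc c h))) ⟩
  c + h ∎)
  where
  open CopyY C
  open ≤-Reasoning
  x : ∀ k → k < suc h → Subset n
  x k l = X (fromℕ< l)
  grow : ∀ k (l : k < suc h) → c + k ≤ ∣ x k l ∣
  grow zero l = ≤-trans (≤-reflexive (+-identityʳ c)) (proj₁ (win (X∈ _)))
  grow (suc k) l = begin
    c + suc k ≡⟨ +-suc c k ⟩
    suc (c + k) ≤⟨ s≤s (grow k k<) ⟩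
    suc ∣ x k k< ∣ ≤⟨ proj₂ (⊆∧≢⇒⊏ (X-chain _ _ k≤1+k) λ e →
                        <-irrefl (trans (sym (toℕ-fromℕ< k<)) (trans (cong toℕ (X-inj _ _ e)) (toℕ-fromℕ< l))) ≤-refl) ⟩
    ∣ x (suc k) l ∣ ∎
    where
    k< : k < suc h
    k< = <⇒≤ l
    k≤1+k : toℕ (fromℕ< k<) ≤ toℕ (fromℕ< l)
    k≤1+k = subst₂ _≤_ (sym (toℕ-fromℕ< k<)) (sym (toℕ-fromℕ< l)) (n≤1+n k)

-- A copy of Y′ in the layers is a copy of Y in their complements, whose sizes again lie in a window
-- of h + 1 values.
layers-Free : ∀ n b h s → Free (suc h) (suc s) (family (layers n b (suc h)) (layers-unique n b (suc h)))
layers-Free n b h s =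
  window⇒¬CopyY F (suc b) (λ A∈ → let (l , m) = layers-size n b (suc h) A∈ in l , s≤s m) ,
  λ C → window⇒¬CopyY (map ∁ F) c window (CopyY'-∁ (subst (CopyY' (suc h) (suc s)) (sym (map∁∁ F)) C))
  where
  open ≤-Reasoning
  F : List (Subset n)
  F = layers n b (suc h)
  c : ℕ
  c = n ∸ (b + suc h)
  window : ∀ {A} → A ∈ map ∁ F → c ≤ ∣ A ∣ × ∣ A ∣ < c + suc h
  window {A} A∈ with layers-size n b (suc h) (∈-∁⁻ A∈)
  ... | l , m = m≤n+o⇒m∸n≤o n (b + suc h) (begin
        n ≡⟨ sym (trans (+-comm ∣ ∁ A ∣ ∣ A ∣) (∣∁∣ A)) ⟩
        ∣ ∁ A ∣ + ∣ A ∣ ≤⟨ +-monoˡ-≤ ∣ A ∣ m ⟩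
        b + suc h + ∣ A ∣ ∎) ,
      +-cancelʳ-≤ b _ _ (begin
        suc ∣ A ∣ + b ≡⟨ sym (+-suc ∣ A ∣ b) ⟩
        ∣ A ∣ + suc b ≤⟨ +-monoʳ-≤ ∣ A ∣ l ⟩
        ∣ A ∣ + ∣ ∁ A ∣ ≡⟨ ∣∁∣ A ⟩
        n ≤⟨ m≤n+m∸n n (b + suc h) ⟩
        b + suc h + c ≡⟨ ring b (suc h) c ⟩
        c + suc h + b ∎)
    where
    ring : ∀ x y z → x + y + z ≡ z + y + x
    ring = solve-∀

theorem1p4 : ∀ (h s : ℕ) → 2 ≤ h → 2 ≤ s →
    ∃ λ n₀ → ∀ (n : ℕ) → n₀ ≤ n → LaRpIs n h s (Sigma n h)
theorem1p4 (suc (suc h)) (suc s) (s≤s (s≤s z≤n)) _ = proj₁ large + H , λ n l →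
  (family (layers n (b n) H) (layers-unique n (b n) H) , layers-Free n (b n) (suc h) s , length-layers n (b n) H) ,
  λ F free → upper-bound F free (≤-trans (m≤n+m H (proj₁ large)) l)
    (λ t t< → proj₂ large t t< n (≤-trans (m≤m+n (proj₁ large) H) l))
  where
  H : ℕ
  H = 2 + h
  b : ℕ → ℕ
  b n = (n ∸ H) / 2
  large : ∃ λ N → ∀ t → t < 6 * suc s → ∀ n → N ≤ n → Large h s t n
  large = uniform (eventually-Large h s) (6 * suc s)
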